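{- Let $p\ge 1$, let $(\mathcal{N},\mathcal{I})$ be a $p$-set system with $|\mathcal{N}|=n$ and rank $r$, let $f:2^{\mathcal{N}}\to\mathbb{R}$ be a non-monotone, non-negative submodular function, and let $\epsilon\in(0,1)$. Then the deterministic algorithm TwinGreedyFast (described in the context), run on $(\mathcal{N},\mathcal{I},f,\epsilon)$, returns a solution $S^*\in\mathcal{I}$ with $\frac{1}{2p+2}-\epsilon$ approximation ratio for the problem $\max\{f(S):S\in\mathcal{I}\}$, i.e. $f(S^*)\ge\left(\frac{1}{2p+2}-\epsilon\right)\max\{f(S):S\in\mathcal{I}\}$, and its time complexity is $\mathcal{O}\left(\frac{n}{\epsilon}\log\frac{r}{\epsilon}\right)$.
   Context: Independence system: a finite ground set $\mathcal{N}$ and a family $\mathcal{I}\subseteq2^{\mathcal{N}}$ with $\emptyset\in\mathcal{I}$ and such that $A\subseteq B\in\mathcal{I}$ implies $A\in\mathcal{I}$. For $X\subseteq Y\subseteq\mathcal{N}$, $X$ is a base of $Y$ if $X\in\mathcal{I}$ and $X\cup\{x\}\notin\mathcal{I}$ for all $x\in Y\setminus X$. An independence system is a $p$-set system ($p\ge1$) if for every $Y\subseteq\mathcal{N}$ and any two bases $X_1,X_2$ of $Y$ we have $|X_1|\le p|X_2|$. Rank: $r=\max\{|S|:S\in\mathcal{I}\}\ge1$. Submodular: $f(X)+f(Y)\ge f(X\cup Y)+f(X\cap Y)$ for all $X,Y\subseteq\mathcal{N}$. Non-negative: $f(X)\ge 0$ for all $X$. Non-monotone: there exist $X\subset Y\subseteq\mathcal{N}$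 with $f(X)>f(Y)$. Marginal gain: $f(X\mid Y)=f(X\cup Y)-f(Y)$, and $f(x\mid Y)=f(\{x\}\mid Y)$; $f(e)=f(\{e\})$. Algorithm TwinGreedyFast: let $\tau_{\max}=\max\{f(e):e\in\mathcal{N},\{e\}\in\mathcal{I}\}$ and $S_1=S_2=\emptyset$. For $\tau=\tau_{\max},\ \tau_{\max}/(1+\epsilon),\ \tau_{\max}/(1+\epsilon)^2,\dots$, as long as $\tau>\epsilon\tau_{\max}/[r(1+\epsilon)]$, do the following: go through the elements $e\in\mathcal{N}\setminus(S_1\cup S_2)$ one by one in arbitrary order; for each such $e$ set, for $j\in\{1,2\}$, $\Delta_j=f(e\mid S_j)$ if $S_j\cup\{e\}\in\mathcal{I}$ and $\Delta_j=-\infty$ otherwise (with the current $S_1,S_2$); let $i\in\arg\max_{j\in\{1,2\}}\Delta_j$ (ties broken arbitrarily); if $\Delta_i\ge\tau$, replace $S_i$ by $S_i\cup\{e\}$. At the end return $S^*\in\arg\max_{X\in\{S_1,S_2\}}f(X)$. Time complexity is measured with $f$ and membership in $\mathcal{I}$ given by oracles, each evaluation of $f$ and each test of membership in $\mathcal{I}$ counting as one step; $\mathcal{O}(\cdot)$ hides an absolute constant and is understood for $r/\epsilon$ bounded away from $1$ (say $r/\epsilon\ge 2$). -}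

module Defs where

open import Algebra.Bundles using (CommutativeRing; Semiring)
import Algebra.Definitions.RawSemiring as RawSemiring
open import Data.Bool.Base using (Bool; true; false; if_then_else_)
open import Data.Fin.Base using (Fin)
open import Data.Fin.Subset
  using (Subset; ⊥; ⁅_⁆; ∁; _∪_; _∩_; _∈_; _∉_; _⊆_; _⊂_; ∣_∣)
open import Data.List.Base using (List; []; _∷_; allFin)
import Data.List.Membership.Propositional as List
open import Data.List.Relation.Unary.Unique.Propositional using (Unique)
open import Data.Maybe.Base using (Maybe; just; nothing)
open import Data.Nat.Base as ℕ using (ℕ; zero; suc)
open import Data.Product.Base using (∃; ∃₂; ∃-syntax; _×_; _,_; map₂)
open import Function.Bundles using (_⇔_)
open import Level using (0ℓ)
open import Relation.Binary.Core using (Rel)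
open import Relation.Binary.Definitions using (Decidable)
open import Relation.Binary.PropositionalEquality.Core using (_≡_)
open import Relation.Binary.Structures using (IsDecTotalOrder)
import Relation.Binary.Construct.Add.Infimum.NonStrict as AddInfimum
import Relation.Binary.Construct.NonStrictToStrict as ToStrict
open import Relation.Nullary using (¬_)
open import Relation.Nullary.Construct.Add.Infimum using (_₋; ⊥₋; [_])
open import Relation.Nullary.Decidable.Core using (does; yes; no)
open import Relation.Unary as U using (Pred)

-- The real numbers, axiomatised up to isomorphism as a Dedekind-complete
-- ordered field.  The order is decidable, as it is classically.  Classically
-- `archimedean` follows from `complete`; it is listed because its witness n is
-- not available constructively otherwise.

record Reals : Set₁ where
  infix  4 _≤_ _<_ _<?_
  infixl 7 _/_
  infix  8 _⁻¹

  field
    commutativeRing : CommutativeRing 0ℓ 0ℓ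

  open CommutativeRing commutativeRing public
    using (Carrier; _≈_; _+_; _*_; _-_; 0#; 1#; semiring)
  open RawSemiring (Semiring.rawSemiring semiring) public using (_^_)
  open RawSemiring (Semiring.rawSemiring semiring) using ()
    renaming (_×_ to _·_)

  fromℕ : ℕ → Carrier
  fromℕ k = k · 1#

  field
    _≤_             : Rel Carrier 0ℓ
    isDecTotalOrder : IsDecTotalOrder _≈_ _≤_
    0≉1             : ¬ (0# ≈ 1#)
    +-monoˡ-≤       : ∀ z {x y} → x ≤ y → x + z ≤ y + z
    *-nonNeg        : ∀ {x y} → 0# ≤ x → 0# ≤ y → 0# ≤ x * y
    -- The value of 0# ⁻¹ is unconstrained.
    _⁻¹             : Carrier → Carrier
    *-inverseʳ      : ∀ {x} → ¬ (x ≈ 0#) → x * x ⁻¹ ≈ 1#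

  open IsDecTotalOrder isDecTotalOrder public
    using (_≤?_)
    renaming (_≟_ to _≈?_)

  IsUpperBound : Pred Carrier 0ℓ → Pred Carrier 0ℓ
  IsUpperBound P u = ∀ {x} → P x → x ≤ u

  IsSupremum : Pred Carrier 0ℓ → Pred Carrier 0ℓ
  IsSupremum P s = IsUpperBound P s × (∀ {u} → IsUpperBound P u → s ≤ u)

  field
    archimedean : ∀ x → ∃[ n ] x ≤ fromℕ n
    complete    : ∀ (P : Pred Carrier 0ℓ) → ∃ P → ∃ (IsUpperBound P) → ∃ (IsSupremum P)

  _<_ : Rel Carrier 0ℓ
  _<_ = ToStrict._<_ _≈_ _≤_

  _<?_ : Decidable _<_
  _<?_ = ToStrict.<-decidable _≈_ _≤_ _≈?_ _≤?_

  _/_ : Carrier → Carrier → Carrier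
  x / y = x * y ⁻¹

  -- For x ≥ 1, log₂ x is the supremum of the rationals a / b ≥ 0 (with b ≥ 1)
  -- such that 2 ^ (a / b) ≤ x, that is, 2 ^ a ≤ x ^ b.
  IsLog₂ : Carrier → Pred Carrier 0ℓ
  IsLog₂ x = IsSupremum λ q →
    ∃₂ λ a b → q ≈ fromℕ a / fromℕ (suc b) × fromℕ 2 ^ a ≤ x ^ suc b

record IndependenceSystem (n : ℕ) : Set₁ where
  field
    Independent  : Pred (Subset n) 0ℓ
    independent? : U.Decidable Independent
    ⊥-indep      : Independent ⊥
    ⊆-indep      : ∀ {A B} → A ⊆ B → Independent B → Independent A

  IsBase : Subset n → Subset n → Set
  IsBase X Y = X ⊆ Y × Independent X ×
    (∀ x → x ∈ Y → x ∉ X → ¬ Independent (X ∪ ⁅ x ⁆))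

  IsRank : ℕ → Set
  IsRank r = (∃[ S ] Independent S × ∣ S ∣ ≡ r) ×
             (∀ S → Independent S → ∣ S ∣ ℕ.≤ r)

module _ (ℝ : Reals) {n : ℕ} where
  open Reals ℝ

  IsPSetSystem : Carrier → IndependenceSystem n → Set
  IsPSetSystem p M = ∀ Y X₁ X₂ → IsBase X₁ Y → IsBase X₂ Y →
    fromℕ ∣ X₁ ∣ ≤ p * fromℕ ∣ X₂ ∣
    where open IndependenceSystem M

  Submodular : (Subset n → Carrier) → Set
  Submodular f = ∀ X Y → f (X ∪ Y) + f (X ∩ Y) ≤ f X + f Y

  NonNegative : (Subset n → Carrier) → Set
  NonNegative f = ∀ X → 0# ≤ f X

  NonMonotone : (Subset n → Carrier) → Set
  NonMonotone f = ∃₂ λ X Y → X ⊂ Y × f Y < f X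

  IsMaximum : IndependenceSystem n → (Subset n → Carrier) → Carrier → Set
  IsMaximum M f m = (∃[ S ] Independent S × f S ≈ m) ×
                    (∀ S → Independent S → f S ≤ m)
    where open IndependenceSystem M

  -- Programs that access f and the independence system only through the value
  -- oracle and the membership oracle.

  data Prog (A : Set) : Set where
    return : A → Prog A
    value  : Subset n → (Carrier → Prog A) → Prog A
    member : Subset n → (Bool → Prog A) → Prog A

  infixl 1 _>>=_
  _>>=_ : {A B : Set} → Prog A → (A → Prog B) → Prog B
  return a   >>= g = g a
  value X k  >>= g = value X (λ v → k v >>= g)
  member X k >>= g = member X (λ b → k b >>= g)

  -- The result of a program together with the number of oracle queries made.
  run : {A : Set} → IndependenceSystem n → (Subset n → Carrier) → Prog A → A × ℕ
  run M f (return a)   = a , 0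
  run M f (value X k)  = map₂ suc (run M f (k (f X)))
  run M f (member X k) = map₂ suc (run M f (k (does (independent? X))))
    where open IndependenceSystem M

  f⟨_⟩ : Subset n → Prog Carrier
  f⟨ X ⟩ = value X return

  indep⟨_⟩ : Subset n → Prog Bool
  indep⟨ X ⟩ = member X return

  -- The reals extended with -∞, which is ⊥₋.
  Carrier₋ : Set
  Carrier₋ = Carrier ₋

  open AddInfimum _≤_ using (_≤₋_; ≤₋-dec)

  infix 4 _≤₋?_
  _≤₋?_ : Decidable _≤₋_
  _≤₋?_ = ≤₋-dec _≤?_

  max₋ : Carrier₋ → Carrier₋ → Carrier₋
  max₋ x y = if does (x ≤₋? y) then y else x

  data Index : Set where
    first second : Index

  -- An index of a larger argument; the given index is used in case of a tie.
  argmax : Index → Carrier₋ → Carrier₋ → Index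
  argmax tie x y with x ≤₋? y | y ≤₋? x
  ... | yes _ | yes _ = tie
  ... | yes _ | no  _ = second
  ... | no  _ | _     = first

  Enumeration : Subset n → Set
  Enumeration X = ∃[ es ] Unique es × (∀ e → e List.∈ es ⇔ e ∈ X)

  -- A resolution of the arbitrary choices.  The ℕ argument is the index of
  -- the pass, i.e. k when τ = τmax / (1 + ε)ᵏ, and the S₁, S₂ argument of
  -- `order` is the state at the start of that pass.
  record Choices : Set where
    field
      order    : ℕ → (S₁ S₂ : Subset n) → Enumeration (∁ (S₁ ∪ S₂))
      tie      : ℕ → Fin n → Index
      finalTie : Index

  State : Set
  State = Subset n × Subset n

  maxSingleton : List (Fin n) → Prog Carrier₋
  maxSingleton []       = return ⊥₋
  maxSingleton (e ∷ es) = do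
    m ← maxSingleton es
    true ← indep⟨ ⁅ e ⁆ ⟩
      where false → return m
    v ← f⟨ ⁅ e ⁆ ⟩
    return (max₋ [ v ] m)

  gain : Fin n → Subset n → Prog Carrier₋
  gain e S = do
    true ← indep⟨ S ∪ ⁅ e ⁆ ⟩
      where false → return ⊥₋
    v ← f⟨ S ∪ ⁅ e ⁆ ⟩
    w ← f⟨ S ⟩
    return [ v - w ]

  insert : Carrier → Fin n → Index → (Δ₁ Δ₂ : Carrier₋) → State → State
  insert τ e first  Δ₁ Δ₂ (S₁ , S₂) =
    (if does ([ τ ] ≤₋? Δ₁) then S₁ ∪ ⁅ e ⁆ else S₁) , S₂
  insert τ e second Δ₁ Δ₂ (S₁ , S₂) =
    S₁ , (if does ([ τ ] ≤₋? Δ₂) then S₂ ∪ ⁅ e ⁆ else S₂)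

  visit : Carrier → Fin n → Index → State → Prog State
  visit τ e t (S₁ , S₂) = do
    Δ₁ ← gain e S₁
    Δ₂ ← gain e S₂
    return (insert τ e (argmax t Δ₁ Δ₂) Δ₁ Δ₂ (S₁ , S₂))

  pass : Carrier → (Fin n → Index) → List (Fin n) → State → Prog State
  pass τ tie []       s = return s
  pass τ tie (e ∷ es) s = do
    s′ ← visit τ e (tie e) s
    pass τ tie es s′

  module Algorithm (choices : Choices) (ε : Carrier) (r : ℕ) where
    open Choices choices

    -- `loop fuel k τmax τ` runs the passes with indices k, k + 1, …, the pass k
    -- having threshold τ.  The result is `nothing` if the loop has
    -- not ended after `fuel` passes.
    loop : ℕ → ℕ → Carrier → Carrier → State → Prog (Maybe State)
    loop fuel k τmax τ s with ε * τmax / (fromℕ r * (1# + ε)) <? τ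
    loop fuel       k τmax τ s           | no  _ = return (just s)
    loop zero       k τmax τ s           | yes _ = return nothing
    loop (suc fuel) k τmax τ s@(S₁ , S₂) | yes _ = do
      let es , _ = order k S₁ S₂
      s′ ← pass τ (tie k) es s
      loop fuel (suc k) τmax (τ / (1# + ε)) s′

    best : State → Prog (Subset n)
    best (S₁ , S₂) = do
      v₁ ← f⟨ S₁ ⟩
      v₂ ← f⟨ S₂ ⟩
      return (pick (argmax finalTie [ v₁ ] [ v₂ ]))
      where
      pick : Index → Subset n
      pick first  = S₁
      pick second = S₂

    -- If no singleton is independent (impossible when r ≥ 1), τmax is
    -- undefined and no result is produced.
    twinGreedyFast : ℕ → Prog (Maybe (Subset n))
    twinGreedyFast fuel = do
      [ τmax ] ← maxSingleton (allFin n)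
        where ⊥₋ → return nothing
      just s ← loop fuel 0 τmax τmax (⊥ , ⊥)
        where nothing → return nothing
      S ← best s
      return (just S)

  open Algorithm public using (twinGreedyFast)

{-# OPTIONS --safe #-}
module Submission where

-- The algorithm keeps two disjoint independent sets S and T.  Let O be an optimal set.  Disjointness,
-- submodularity and non-negativity give f O ≤ f (S ∪ O) + f (T ∪ O), and by submodularity again
-- f (S ∪ O) - f S is at most the sum of the marginal gains f (e | S) over e in O, and likewise for T
-- (`f[O]≤f[S∪O]+f[T∪O]`, `union-gain`).  So these gains have to be paid for out of f S and f T.
--
-- Say that S captures an element e of O if e lies in S or S ∪ {e} is dependent.  Then S is a base of
-- its union with the captured elements, so the p-set property bounds their number by p |S|
-- (`captured-bound`).  An insertion into S at threshold τ raises f S by at least τ.  Let it pay p τ,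
-- and let an element captured at threshold τ cost τ.  As the thresholds decrease and there are never
-- more than p |S| captured elements, summation by parts shows that the payments cover the costs, so
-- the total cost is at most p (f S - f ∅) (`charge-total`).  The summation is carried out along the
-- run: an element has a credit that is constant during a pass, its cost is the credit plus τ if it is
-- captured, and when τ decreases the credits of the captured elements rise by the difference
-- (`Account`, `insert-Invariant`, `end-Account`).
--
-- The gains are within a factor 1 + ε of these costs.  An element outside S and T that S does not yet
-- capture when the threshold is τ was either rejected at the threshold (1 + ε) τ of the preceding
-- pass, or τ is the first threshold τmax; in both cases its gain is at most (1 + ε) τ, and it can
-- only decrease later on.  An element inserted into T when S could have been enlarged by it has at
-- most the gain for S that it has for T, so the cost that T bears for it pays for its gain for S.  An
-- element that remains uncaptured has a gain of at most (1 + ε) τ for the final threshold τ, which is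
-- at most ε τmax / (r (1 + ε)); all these together contribute at most 2 ε f O.  Hence, S* being the
-- better of the two sets,
--
--   f O ≤ 2 f S* + 2 (1 + ε) p f S* + 2 ε f O
--
-- (`optimum-bound`), from which the ratio follows since f S* ≤ f O (`approximation-ratio`).
--
-- For the complexity, (1 + ε) ^ ⌈ 1 / ε ⌉ ≥ 2 by Bernoulli's inequality, so ⌈ 1 / ε ⌉ passes at least
-- halve the threshold and ⌈ 1 / ε ⌉ (⌈ log₂ (r / ε) ⌉ + 1) passes finish the loop (`threshold`).  If
-- r / ε ≥ 2, this is at most (6 / ε) log₂ (r / ε), and a pass makes at most 6 n queries
-- (`total-queries`).

open import Defs
open import Algebra.Bundles using (CommutativeRing)
import Algebra.Properties.CommutativeMonoid.Sum as Sum
import Algebra.Properties.Ring as RingProperties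
import Algebra.Properties.Semiring.Exp as Exp
import Algebra.Properties.Semiring.Mult as Mult
import Algebra.Properties.Semiring.Sum as SemiringSum
import Algebra.Solver.Ring.NaturalCoefficients.Default as NaturalSolver
open import Data.Bool.Base using (Bool; true; false; if_then_else_)
open import Data.Fin.Base using (Fin; zero; suc)
import Data.Fin.Properties as Fin
open import Data.Fin.Subset
  using (Subset; ⊥; ⁅_⁆; _∪_; _∩_; _∈_; _∉_; _⊆_; ∣_∣; inside; outside)
  renaming (_-_ to _∖_)
open import Data.Fin.Subset.Properties
open import Data.List.Base as List using (List; []; _∷_; allFin; length)
import Data.List.Membership.Propositional as List
open import Data.List.Membership.Propositional.Properties using (∈-allFin; ∈-lookup)
open import Data.List.Properties using (length-tabulate)
open import Data.List.Relation.Unary.All as All using (All)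
open import Data.List.Relation.Unary.AllPairs using (_∷_)
open import Data.List.Relation.Unary.Any using (here; there)
open import Data.List.Relation.Unary.Unique.Propositional using (Unique)
open import Data.Maybe.Base using (just)
open import Data.Nat.Base as ℕ using (ℕ; zero; suc)
import Data.Nat.Properties as ℕ
open import Data.Product.Base using (∃; ∃₂; ∃-syntax; _×_; _,_; proj₁; proj₂; map₂)
open import Data.Sum.Base using (_⊎_; inj₁; inj₂; [_,_]′)
open import Data.Vec.Base using ([]; _∷_; there; lookup; tabulate)
open import Data.Vec.Properties using (lookup∘tabulate; []=⇒lookup; lookup⇒[]=)
open import Function.Base using (_∘_; id)
open import Function.Bundles using (module Equivalence)
open import Level using (0ℓ)
open import Relation.Binary.Bundles using (Poset)
import Relation.Binary.Construct.Add.Infimum.NonStrict as AddInfimum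
import Relation.Binary.Construct.NonStrictToStrict as ToStrict
import Relation.Binary.PropositionalEquality as ≡
open import Relation.Binary.PropositionalEquality.Core using (_≡_; _≢_; refl)
import Relation.Binary.Reasoning.PartialOrder as PosetReasoning
open import Relation.Binary.Structures using (IsDecTotalOrder)
open import Relation.Nullary using (¬_; yes; no; contradiction; does)
open import Relation.Nullary.Construct.Add.Infimum using (⊥₋; [_])
open import Relation.Nullary.Decidable using (_×-dec_; _⊎-dec_; ¬?; dec-true)
open import Relation.Unary as U using (Pred)

-- Ordered fields and binary logarithms

module OrderedField (ℝ : Reals) where
  open Reals ℝ
  open CommutativeRing commutativeRing
    using (ring; commutativeSemiring; -_; +-identityˡ; +-identityʳ; +-comm; +-assoc; *-comm
          ; *-assoc; *-identityˡ; *-identityʳ; +-congˡ; *-cong; *-congˡ; *-congʳ; zeroˡ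
          ; zeroʳ; -‿inverseʳ; -‿cong; distribˡ)
    renaming (refl to ≈-refl; sym to ≈-sym; trans to ≈-trans)
  open IsDecTotalOrder isDecTotalOrder public using ()
    renaming ( refl to ≤-refl; trans to ≤-trans; reflexive to ≤-reflexive
             ; antisym to ≤-antisym; total to ≤-total; isPartialOrder to ≤-isPartialOrder)
  open NaturalSolver commutativeSemiring using (solve; _:+_; _:*_; _:=_; con)
  open RingProperties ring using (-‿distribˡ-*; -‿involutive)
  open Exp semiring using (^-assocʳ)
  open Mult semiring using (×-homo-+; ×1-homo-*)

  ≤-poset : Poset _ _ _
  ≤-poset = record { isPartialOrder = ≤-isPartialOrder }

  open PosetReasoning ≤-poset

  <⇒≤ : ∀ {x y} → x < y → x ≤ y
  <⇒≤ = proj₁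

  <⇒≱ : ∀ {x y} → x < y → ¬ (y ≤ x)
  <⇒≱ = ToStrict.<⇒≱ _≈_ _≤_ ≤-antisym

  ≮⇒≥ : ∀ {x y} → ¬ (x < y) → y ≤ x
  ≮⇒≥ = ToStrict.≮⇒≥ _≈_ _≤_ ≈-sym _≈?_ ≤-reflexive ≤-total

  <-≤-trans : ∀ {x y z} → x < y → y ≤ z → x < z
  <-≤-trans = ToStrict.<-≤-trans _≈_ _≤_ ≈-sym ≤-trans ≤-antisym
                (λ y≈z x≤y → ≤-trans x≤y (≤-reflexive y≈z))

  +-mono-≤ : ∀ {x y u v} → x ≤ y → u ≤ v → x + u ≤ y + v
  +-mono-≤ {x} {y} {u} {v} x≤y u≤v = begin
    x + u ≤⟨ +-monoˡ-≤ u x≤y ⟩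
    y + u ≈⟨ +-comm y u ⟩
    u + y ≤⟨ +-monoˡ-≤ y u≤v ⟩
    v + y ≈⟨ +-comm v y ⟩
    y + v ∎

  +-monoʳ-≤ : ∀ z {x y} → x ≤ y → z + x ≤ z + y
  +-monoʳ-≤ z = +-mono-≤ ≤-refl

  x+z-z≈x : ∀ x z → x + z + - z ≈ x
  x+z-z≈x x z = ≈-trans (+-assoc x z (- z)) (≈-trans (+-congˡ (-‿inverseʳ z)) (+-identityʳ x))

  x-z+z≈x : ∀ x z → x - z + z ≈ x
  x-z+z≈x x z = ≈-trans (+-assoc x (- z) z)
    (≈-trans (+-congˡ (≈-trans (+-comm (- z) z) (-‿inverseʳ z))) (+-identityʳ x))

  +-cancelʳ-≤ : ∀ z {x y} → x + z ≤ y + z → x ≤ y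
  +-cancelʳ-≤ z {x} {y} h = begin
    x         ≈⟨ x+z-z≈x x z ⟨
    x + z - z ≤⟨ +-monoˡ-≤ (- z) h ⟩
    y + z - z ≈⟨ x+z-z≈x y z ⟩
    y         ∎

  -- The inequality x ≤ y follows from u ≤ v when both have the same slack, y - x ≈ v - u.  The
  -- slacks are compared by an equation without subtraction, as a semiring solver requires.
  linear : ∀ {u v x y} → u ≤ v → x + v ≈ y + u → x ≤ y
  linear {u} {v} {x} {y} u≤v eq = +-cancelʳ-≤ v (begin
    x + v ≈⟨ eq ⟩
    y + u ≤⟨ +-monoʳ-≤ y u≤v ⟩
    y + v ∎)

  ≤-difference : ∀ {x y z} → x + y ≤ z → x ≤ z - y
  ≤-difference {x} {y} {z} h = +-cancelʳ-≤ y (≤-trans h (≤-reflexive (≈-sym (x-z+z≈x z y))))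

  ≤-difference⁻¹ : ∀ {x y z} → x ≤ z - y → x + y ≤ z
  ≤-difference⁻¹ {x} {y} {z} h = ≤-trans (+-monoˡ-≤ y h) (≤-reflexive (x-z+z≈x z y))

  difference-≤⁻¹ : ∀ {x y z} → z - y ≤ x → z ≤ x + y
  difference-≤⁻¹ {x} {y} {z} h = ≤-trans (≤-reflexive (≈-sym (x-z+z≈x z y))) (+-monoˡ-≤ y h)

  -- If a gain a - t is at most b - s, and b - s is at most c, then a - t is at most c.
  gain-trans : ∀ {a b c s t} → a + s ≤ t + b → b ≤ s + c → a ≤ t + c
  gain-trans {a} {b} {c} {s} {t} a-t≤b-s b-s≤c = linear (+-mono-≤ a-t≤b-s b-s≤c)
    (solve 5 (λ a b c s t → a :+ (t :+ b :+ (s :+ c)) := t :+ c :+ (a :+ s :+ b)) ≈-refl a b c s t)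

  ≡⇒≤ : ∀ {x y} → x ≡ y → x ≤ y
  ≡⇒≤ refl = ≤-refl

  x+x≈2x : ∀ x → x + x ≈ fromℕ 2 * x
  x+x≈2x = solve 1 (λ x → x :+ x := (con 1 :+ (con 1 :+ con 0)) :* x) ≈-refl

  +-nonNeg : ∀ {x y} → 0# ≤ x → 0# ≤ y → 0# ≤ x + y
  +-nonNeg {x} {y} 0≤x 0≤y = ≤-trans (≤-reflexive (≈-sym (+-identityˡ 0#))) (+-mono-≤ 0≤x 0≤y)

  x≤x+y : ∀ {x y} → 0# ≤ y → x ≤ x + y
  x≤x+y {x} {y} 0≤y = ≤-trans (≤-reflexive (≈-sym (+-identityʳ x))) (+-monoʳ-≤ x 0≤y)

  x≤y+x : ∀ {x y} → 0# ≤ y → x ≤ y + x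
  x≤y+x {x} {y} 0≤y = ≤-trans (x≤x+y 0≤y) (≤-reflexive (+-comm x y))

  *-monoˡ-≤ : ∀ {c x y} → 0# ≤ c → x ≤ y → c * x ≤ c * y
  *-monoˡ-≤ {c} {x} {y} 0≤c x≤y = begin
    c * x               ≈⟨ +-identityˡ _ ⟨
    0# + c * x          ≤⟨ +-monoˡ-≤ _ (*-nonNeg 0≤c 0≤y-x) ⟩
    c * (y - x) + c * x ≈⟨ distribˡ c (y - x) x ⟨
    c * (y - x + x)     ≈⟨ *-congˡ (x-z+z≈x y x) ⟩
    c * y               ∎
    where
    0≤y-x : 0# ≤ y - x
    0≤y-x = ≤-difference (≤-trans (≤-reflexive (+-identityˡ x)) x≤y)

  *-monoʳ-≤ : ∀ {c x y} → 0# ≤ c → x ≤ y → x * c ≤ y * c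
  *-monoʳ-≤ {c} {x} {y} 0≤c x≤y = begin
    x * c ≈⟨ *-comm x c ⟩
    c * x ≤⟨ *-monoˡ-≤ 0≤c x≤y ⟩
    c * y ≈⟨ *-comm c y ⟩
    y * c ∎

  *-mono-≤ : ∀ {x y u v} → 0# ≤ y → 0# ≤ u → x ≤ y → u ≤ v → x * u ≤ y * v
  *-mono-≤ 0≤y 0≤u x≤y u≤v = ≤-trans (*-monoʳ-≤ 0≤u x≤y) (*-monoˡ-≤ 0≤y u≤v)

  0≤1 : 0# ≤ 1#
  0≤1 with ≤-total 0# 1#
  ... | inj₁ 0≤1 = 0≤1
  ... | inj₂ 1≤0 = begin
    0#                    ≤⟨ *-nonNeg 0≤-1 0≤-1 ⟩
    (0# - 1#) * (0# - 1#) ≈⟨ *-cong (+-identityˡ _) (+-identityˡ _) ⟩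
    (- 1#) * (- 1#)       ≈⟨ -‿distribˡ-* 1# (- 1#) ⟨
    - (1# * (- 1#))       ≈⟨ -‿cong (*-identityˡ _) ⟩
    - (- 1#)              ≈⟨ -‿involutive 1# ⟩
    1#                    ∎
    where
    0≤-1 : 0# ≤ 0# - 1#
    0≤-1 = ≤-difference (≤-trans (≤-reflexive (+-identityˡ 1#)) 1≤0)

  0<1 : 0# < 1#
  0<1 = 0≤1 , 0≉1

  <⇒≉0 : ∀ {x} → 0# < x → ¬ (x ≈ 0#)
  <⇒≉0 (_ , 0≉x) x≈0 = 0≉x (≈-sym x≈0)

  ⁻¹-nonNeg : ∀ {x} → 0# < x → 0# ≤ x ⁻¹
  ⁻¹-nonNeg {x} 0<x with ≤-total 0# (x ⁻¹)
  ... | inj₁ h = h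
  ... | inj₂ h = contradiction (begin
    1#       ≈⟨ *-inverseʳ (<⇒≉0 0<x) ⟨
    x * x ⁻¹ ≤⟨ *-monoˡ-≤ (<⇒≤ 0<x) h ⟩
    x * 0#   ≈⟨ zeroʳ x ⟩
    0#       ∎) (<⇒≱ 0<1)

  *-/ : ∀ {x} y → 0# < x → x * (y / x) ≈ y
  *-/ {x} y 0<x = begin-equality
    x * (y * x ⁻¹) ≈⟨ solve 3 (λ x y z → x :* (y :* z) := y :* (x :* z)) ≈-refl x y (x ⁻¹) ⟩
    y * (x * x ⁻¹) ≈⟨ *-congˡ (*-inverseʳ (<⇒≉0 0<x)) ⟩
    y * 1#         ≈⟨ *-identityʳ y ⟩
    y              ∎

  *-cancelˡ-≤ : ∀ {c x y} → 0# < c → c * x ≤ c * y → x ≤ y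
  *-cancelˡ-≤ {c} {x} {y} 0<c h = begin
    x              ≈⟨ *-/ x 0<c ⟨
    c * (x / c)    ≈⟨ *-assoc c x (c ⁻¹) ⟨
    c * x * c ⁻¹   ≤⟨ *-monoʳ-≤ (⁻¹-nonNeg 0<c) h ⟩
    c * y * c ⁻¹   ≈⟨ *-assoc c y (c ⁻¹) ⟩
    c * (y / c)    ≈⟨ *-/ y 0<c ⟩
    y              ∎

  ≤-/ : ∀ {c x y} → 0# < c → c * x ≤ y → x ≤ y / c
  ≤-/ 0<c h = *-cancelˡ-≤ 0<c (≤-trans h (≤-reflexive (≈-sym (*-/ _ 0<c))))

  /-≤ : ∀ {c x y} → 0# < c → x ≤ c * y → x / c ≤ y
  /-≤ 0<c h = *-cancelˡ-≤ 0<c (≤-trans (≤-reflexive (*-/ _ 0<c)) h)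

  /-nonNeg : ∀ {x y} → 0# ≤ x → 0# < y → 0# ≤ x / y
  /-nonNeg 0≤x 0<y = *-nonNeg 0≤x (⁻¹-nonNeg 0<y)

  fromℕ-nonNeg : ∀ k → 0# ≤ fromℕ k
  fromℕ-nonNeg zero    = ≤-refl
  fromℕ-nonNeg (suc k) = +-nonNeg 0≤1 (fromℕ-nonNeg k)

  fromℕ-mono-≤ : ∀ {j k} → j ℕ.≤ k → fromℕ j ≤ fromℕ k
  fromℕ-mono-≤ {k = k} ℕ.z≤n = fromℕ-nonNeg k
  fromℕ-mono-≤ (ℕ.s≤s j≤k) = +-monoʳ-≤ 1# (fromℕ-mono-≤ j≤k)

  fromℕ-+ : ∀ j k → fromℕ (j ℕ.+ k) ≈ fromℕ j + fromℕ k
  fromℕ-+ = ×-homo-+ 1#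

  fromℕ-* : ∀ j k → fromℕ (j ℕ.* k) ≈ fromℕ j * fromℕ k
  fromℕ-* = ×1-homo-*

  1≤fromℕ : ∀ k .{{_ : ℕ.NonZero k}} → 1# ≤ fromℕ k
  1≤fromℕ (suc k) = x≤x+y (fromℕ-nonNeg k)

  0<fromℕ : ∀ k .{{_ : ℕ.NonZero k}} → 0# < fromℕ k
  0<fromℕ k = <-≤-trans 0<1 (1≤fromℕ k)

  fromℕ-^ : ∀ j k → fromℕ (j ℕ.^ k) ≈ fromℕ j ^ k
  fromℕ-^ j zero    = +-identityʳ 1#
  fromℕ-^ j (suc k) = ≈-trans (fromℕ-* j (j ℕ.^ k)) (*-congˡ (fromℕ-^ j k))

  fromℕ-cancel-≤ : ∀ {j k} → fromℕ j ≤ fromℕ k → j ℕ.≤ k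
  fromℕ-cancel-≤ {j} {k} h with j ℕ.≤? k
  ... | yes j≤k = j≤k
  ... | no  j≰k = contradiction (+-cancelʳ-≤ (fromℕ k) (begin
    1# + fromℕ k ≤⟨ fromℕ-mono-≤ (ℕ.≰⇒> j≰k) ⟩
    fromℕ j      ≤⟨ h ⟩
    fromℕ k      ≈⟨ +-identityˡ _ ⟨
    0# + fromℕ k ∎)) (<⇒≱ 0<1)

  ^-nonNeg : ∀ {x} k → 0# ≤ x → 0# ≤ x ^ k
  ^-nonNeg zero    0≤x = 0≤1
  ^-nonNeg (suc k) 0≤x = *-nonNeg 0≤x (^-nonNeg k 0≤x)

  ^-mono-≤ : ∀ {x y} k → 0# ≤ x → x ≤ y → x ^ k ≤ y ^ k
  ^-mono-≤ zero    0≤x x≤y = ≤-refl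
  ^-mono-≤ (suc k) 0≤x x≤y =
    *-mono-≤ (≤-trans 0≤x x≤y) (^-nonNeg k 0≤x) x≤y (^-mono-≤ k 0≤x x≤y)

  bernoulli : ∀ {x} k → 0# ≤ x → 1# + fromℕ k * x ≤ (1# + x) ^ k
  bernoulli {x} zero    0≤x = ≤-reflexive (≈-trans (+-congˡ (zeroˡ x)) (+-identityʳ 1#))
  bernoulli {x} (suc k) 0≤x = begin
    1# + (1# + fromℕ k) * x
      ≤⟨ x≤x+y (*-nonNeg 0≤x (*-nonNeg (fromℕ-nonNeg k) 0≤x)) ⟩
    1# + (1# + fromℕ k) * x + x * (fromℕ k * x)
      ≈⟨ solve 2 (λ x k → con 1 :+ (con 1 :+ k) :* x :+ x :* (k :* x)
                       := (con 1 :+ x) :* (con 1 :+ k :* x)) ≈-refl x (fromℕ k) ⟩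
    (1# + x) * (1# + fromℕ k * x)
      ≤⟨ *-monoˡ-≤ (+-nonNeg 0≤1 0≤x) (bernoulli k 0≤x) ⟩
    (1# + x) * (1# + x) ^ k ∎

  -- An index k with x ≤ g k such that the preceding term, if there is one, is at most x.
  least : ∀ (g : ℕ → Carrier) x N → x ≤ g N →
          ∃[ k ] x ≤ g k × (∀ {j} → k ≡ suc j → g j ≤ x)
  least g x zero    x≤g = zero , x≤g , λ ()
  least g x (suc N) x≤g with x ≤? g N
  ... | yes x≤gN = least g x N x≤gN
  ... | no  x≰gN = suc N , x≤g , λ where
    refl → [ (λ x≤gN → contradiction x≤gN x≰gN) , id ]′ (≤-total x (g N))

  k≤2^k : ∀ k → k ℕ.≤ 2 ℕ.^ k
  k≤2^k zero    = ℕ.z≤n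
  k≤2^k (suc k) = ℕ.+-mono-≤ (ℕ.m^n>0 2 k) (ℕ.≤-trans (k≤2^k k) (ℕ.m≤m+n _ _))

  2^-cancel-≤ : ∀ {j k} → 2 ℕ.^ j ℕ.≤ 2 ℕ.^ k → j ℕ.≤ k
  2^-cancel-≤ {j} {k} h with j ℕ.≤? k
  ... | yes j≤k = j≤k
  ... | no  j≰k = contradiction h (ℕ.<⇒≱ (ℕ.^-monoʳ-< 2 (ℕ.s≤s (ℕ.s≤s ℕ.z≤n)) (ℕ.≰⇒> j≰k)))

  -- The binary logarithm of x, rounded up to a natural number a: if a is positive, then x lies between
  -- 2 ^ (a - 1) and 2 ^ a.
  ceilLog₂ : ∀ x → ∃[ a ] x ≤ fromℕ 2 ^ a × (∀ {j} → a ≡ suc j → fromℕ 2 ^ j ≤ x)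
  ceilLog₂ x with archimedean x
  ... | N , x≤N = least (fromℕ 2 ^_) x N (begin
    x               ≤⟨ x≤N ⟩
    fromℕ N         ≤⟨ fromℕ-mono-≤ (k≤2^k N) ⟩
    fromℕ (2 ℕ.^ N) ≈⟨ fromℕ-^ 2 N ⟩
    fromℕ 2 ^ N     ∎)

  2^a≤x⇒a≤log₂ : ∀ {x L} → IsLog₂ x L → ∀ a → fromℕ 2 ^ a ≤ x → fromℕ a ≤ L
  2^a≤x⇒a≤log₂ {x} {L} (upper , _) a 2^a≤x = begin
    fromℕ a           ≤⟨ ≤-/ (0<fromℕ 1) (≤-reflexive 1*a≈a) ⟩
    fromℕ a / fromℕ 1 ≤⟨ upper (a , 0 , ≈-refl , ≤-trans 2^a≤x (≤-reflexive (≈-sym (*-identityʳ x)))) ⟩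
    L                 ∎
    where
    1*a≈a : fromℕ 1 * fromℕ a ≈ fromℕ a
    1*a≈a = ≈-trans (*-congʳ (+-identityʳ 1#)) (*-identityˡ _)

  log₂-exists : ∀ {x} → 1# ≤ x → ∃ (IsLog₂ x)
  log₂-exists {x} 1≤x with ceilLog₂ x
  ... | N , x≤2^N , _ = complete _
    -- The fraction 0 / 1 shows that the set of lower approximations is inhabited.
    (_ , 0 , 0 , ≈-refl , ≤-trans 1≤x (≤-reflexive (≈-sym (*-identityʳ x))))
    (fromℕ N , bound)
    where
    bound : IsUpperBound
      (λ q → ∃₂ λ a b → q ≈ fromℕ a / fromℕ (suc b) × fromℕ 2 ^ a ≤ x ^ suc b) (fromℕ N)
    bound {q} (a , b , q≈a/b , 2^a≤x^b) = begin
      q                       ≈⟨ q≈a/b ⟩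
      fromℕ a / fromℕ (suc b) ≤⟨ /-≤ (0<fromℕ (suc b)) a≤bN ⟩
      fromℕ N                 ∎
      where
      2^a≤2^[Nb] : fromℕ (2 ℕ.^ a) ≤ fromℕ (2 ℕ.^ (N ℕ.* suc b))
      2^a≤2^[Nb] = begin
        fromℕ (2 ℕ.^ a)               ≈⟨ fromℕ-^ 2 a ⟩
        fromℕ 2 ^ a                   ≤⟨ 2^a≤x^b ⟩
        x ^ suc b                     ≤⟨ ^-mono-≤ (suc b) (≤-trans 0≤1 1≤x) x≤2^N ⟩
        (fromℕ 2 ^ N) ^ suc b         ≈⟨ ^-assocʳ (fromℕ 2) N (suc b) ⟩
        fromℕ 2 ^ (N ℕ.* suc b)       ≈⟨ fromℕ-^ 2 (N ℕ.* suc b) ⟨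
        fromℕ (2 ℕ.^ (N ℕ.* suc b))   ∎
      a≤bN : fromℕ a ≤ fromℕ (suc b) * fromℕ N
      a≤bN = begin
        fromℕ a                 ≤⟨ fromℕ-mono-≤ (2^-cancel-≤ {a} {N ℕ.* suc b}
                                     (fromℕ-cancel-≤ {2 ℕ.^ a} {2 ℕ.^ (N ℕ.* suc b)} 2^a≤2^[Nb])) ⟩
        fromℕ (N ℕ.* suc b)     ≈⟨ fromℕ-* N (suc b) ⟩
        fromℕ N * fromℕ (suc b) ≈⟨ *-comm _ _ ⟩
        fromℕ (suc b) * fromℕ N ∎

-- Finite subsets

module _ {n : ℕ} where

  ∪-⊆ : ∀ {A B C : Subset n} → A ⊆ C → B ⊆ C → A ∪ B ⊆ C
  ∪-⊆ {A} {B} A⊆C B⊆C x∈A∪B = [ A⊆C , B⊆C ]′ (x∈p∪q⁻ A B x∈A∪B)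

  ⁅⁆-⊆ : ∀ {e} {A : Subset n} → e ∈ A → ⁅ e ⁆ ⊆ A
  ⁅⁆-⊆ {e} {A} e∈A x∈⁅e⁆ = ≡.subst (_∈ A) (≡.sym (x∈⁅y⁆⇒x≡y e x∈⁅e⁆)) e∈A

  e∈A∪⁅e⁆ : ∀ {e} {A : Subset n} → e ∈ A ∪ ⁅ e ⁆
  e∈A∪⁅e⁆ {e} {A} = q⊆p∪q A ⁅ e ⁆ (x∈⁅x⁆ e)

  ∪-mono-⊆ : ∀ {A B C D : Subset n} → A ⊆ C → B ⊆ D → A ∪ B ⊆ C ∪ D
  ∪-mono-⊆ {C = C} {D} A⊆C B⊆D = ∪-⊆ (p⊆p∪q D ∘ A⊆C) (q⊆p∪q C D ∘ B⊆D)

  ∪⁅⁆-absorb : ∀ {e} {A : Subset n} → e ∈ A → A ∪ ⁅ e ⁆ ≡ A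
  ∪⁅⁆-absorb e∈A = ⊆-antisym (∪-⊆ id (⁅⁆-⊆ e∈A)) (p⊆p∪q _)

  ∉-∪⁅⁆ : ∀ {e v} {A : Subset n} → e ∉ A → e ≢ v → e ∉ A ∪ ⁅ v ⁆
  ∉-∪⁅⁆ {v = v} {A} e∉A e≢v = [ e∉A , e≢v ∘ x∈⁅y⁆⇒x≡y v ]′ ∘ x∈p∪q⁻ A ⁅ v ⁆

  ∈-∪⁅⁆⁻ : ∀ {e v} {A : Subset n} → e ∈ A ∪ ⁅ v ⁆ → e ∈ A ⊎ e ≡ v
  ∈-∪⁅⁆⁻ {v = v} {A} e∈ with x∈p∪q⁻ A ⁅ v ⁆ e∈
  ... | inj₁ e∈A = inj₁ e∈A
  ... | inj₂ e∈v = inj₂ (x∈⁅y⁆⇒x≡y v e∈v)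

  -- The subset of the elements that satisfy a decidable predicate.
  comprehension : {P : Pred (Fin n) 0ℓ} → U.Decidable P → Subset n
  comprehension P? = tabulate (does ∘ P?)

  ∈-comprehension⁺ : ∀ {P : Pred (Fin n) 0ℓ} (P? : U.Decidable P) {e} → P e → e ∈ comprehension P?
  ∈-comprehension⁺ P? {e} Pe =
    lookup⇒[]= e _ (≡.trans (lookup∘tabulate (does ∘ P?) e) (dec-true (P? e) Pe))

  ∈-comprehension⁻ : ∀ {P : Pred (Fin n) 0ℓ} (P? : U.Decidable P) {e} → e ∈ comprehension P? → P e
  ∈-comprehension⁻ P? {e} e∈ with P? e in eq
  ... | yes Pe = Pe
  ... | no  _  = contradiction
    (≡.trans (≡.sym ([]=⇒lookup e∈)) (≡.trans (lookup∘tabulate (does ∘ P?) e) (≡.cong does eq))) λ ()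

∣A∪⁅e⁆∣≤1+∣A∣ : ∀ {n} (A : Subset n) e → ∣ A ∪ ⁅ e ⁆ ∣ ℕ.≤ suc ∣ A ∣
∣A∪⁅e⁆∣≤1+∣A∣ (outside ∷ A) zero    = ℕ.s≤s (ℕ.≤-reflexive (≡.cong ∣_∣ (∪-identityʳ A)))
∣A∪⁅e⁆∣≤1+∣A∣ (inside  ∷ A) zero    = ℕ.s≤s
  (ℕ.≤-trans (ℕ.≤-reflexive (≡.cong ∣_∣ (∪-identityʳ A))) (ℕ.n≤1+n _))
∣A∪⁅e⁆∣≤1+∣A∣ (outside ∷ A) (suc e) = ∣A∪⁅e⁆∣≤1+∣A∣ A e
∣A∪⁅e⁆∣≤1+∣A∣ (inside  ∷ A) (suc e) = ℕ.s≤s (∣A∪⁅e⁆∣≤1+∣A∣ A e)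

x∉p∖x : ∀ {n} (p : Subset n) x → x ∉ p ∖ x
x∉p∖x (s ∷ p) zero    ()
x∉p∖x (s ∷ p) (suc x) (there x∈) = x∉p∖x p x x∈

∣A∣≥1⇒∃∈ : ∀ {n} (A : Subset n) → 1 ℕ.≤ ∣ A ∣ → ∃ (_∈ A)
∣A∣≥1⇒∃∈ {n} A 1≤∣A∣ with nonempty? A
... | yes A≢⊥ = A≢⊥
... | no  A≡⊥ = contradiction 1≤∣A∣ (≡.subst (λ k → ¬ (1 ℕ.≤ k))
  (≡.sym (≡.trans (≡.cong ∣_∣ (Empty-unique A≡⊥)) (∣⊥∣≡0 n))) λ ())

-- Independence systems

module _ {n : ℕ} (M : IndependenceSystem n) where
  open IndependenceSystem M

  -- Greedy extension: going through es, each element of Y that keeps the set independent is added.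
  extend : ∀ Y (es : List (Fin n)) X → X ⊆ Y → Independent X →
    ∃[ X′ ] X ⊆ X′ × X′ ⊆ Y × Independent X′ ×
      (∀ x → x List.∈ es → x ∈ Y → x ∉ X′ → ¬ Independent (X′ ∪ ⁅ x ⁆))
  extend Y []       X X⊆Y ind = X , id , X⊆Y , ind , λ _ ()
  extend Y (e ∷ es) X X⊆Y ind with e ∈? Y | independent? (X ∪ ⁅ e ⁆)
  ... | yes e∈Y | yes indₑ =
    let X′ , Xe⊆X′ , X′⊆Y , ind′ , maximal = extend Y es (X ∪ ⁅ e ⁆) (∪-⊆ X⊆Y (⁅⁆-⊆ e∈Y)) indₑ
    in X′ , Xe⊆X′ ∘ p⊆p∪q _ , X′⊆Y , ind′ , λ where
      x (here refl) _   x∉X′ → contradiction (Xe⊆X′ e∈A∪⁅e⁆) x∉X′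
      x (there x∈es) → maximal x x∈es
  ... | no e∉Y | _ =
    let X′ , X⊆X′ , X′⊆Y , ind′ , maximal = extend Y es X X⊆Y ind
    in X′ , X⊆X′ , X′⊆Y , ind′ , λ where
      x (here refl) x∈Y → contradiction x∈Y e∉Y
      x (there x∈es)    → maximal x x∈es
  ... | yes _ | no dep =
    let X′ , X⊆X′ , X′⊆Y , ind′ , maximal = extend Y es X X⊆Y ind
    in X′ , X⊆X′ , X′⊆Y , ind′ , λ where
      x (here refl) _ _ → dep ∘ ⊆-indep (∪-mono-⊆ X⊆X′ id)
      x (there x∈es)    → maximal x x∈es

  base-extending : ∀ {X Y} → X ⊆ Y → Independent X → ∃[ B ] X ⊆ B × IsBase B Y
  base-extending {X} {Y} X⊆Y ind =
    let B , X⊆B , B⊆Y , indB , maximal = extend Y (allFin n) X X⊆Y ind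
    in B , X⊆B , B⊆Y , indB , λ x → maximal x (∈-allFin x)

  -- An element of O is captured by S if it lies in S or makes S dependent when added.
  Captured : Subset n → Subset n → Pred (Fin n) 0ℓ
  Captured O S e = e ∈ O × (e ∈ S ⊎ ¬ Independent (S ∪ ⁅ e ⁆))

  captured? : ∀ O S → U.Decidable (Captured O S)
  captured? O S e = (e ∈? O) ×-dec ((e ∈? S) ⊎-dec ¬? (independent? (S ∪ ⁅ e ⁆)))

  captured : Subset n → Subset n → Subset n
  captured O S = comprehension (captured? O S)

  Captured-mono : ∀ {O S S′} → S ⊆ S′ → ∀ {e} → Captured O S e → Captured O S′ e
  Captured-mono S⊆S′ (e∈O , inj₁ e∈S) = e∈O , inj₁ (S⊆S′ e∈S)
  Captured-mono S⊆S′ (e∈O , inj₂ dep) = e∈O , inj₂ (dep ∘ ⊆-indep (∪-mono-⊆ S⊆S′ id))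

module _ (ℝ : Reals) {n : ℕ} (M : IndependenceSystem n) where
  open Reals ℝ
  open OrderedField ℝ
  open IndependenceSystem M
  open PosetReasoning ≤-poset

  -- S is a base of the union Y of S with the set C of captured elements, and C, being a subset of O,
  -- is independent and extends to another base of Y.
  captured-bound : ∀ {p} → 0# ≤ p → IsPSetSystem ℝ p M → ∀ {O S} → Independent O → Independent S →
    fromℕ ∣ captured M O S ∣ ≤ p * fromℕ ∣ S ∣
  captured-bound {p} 0≤p isP {O} {S} indO indS =
    let B , C⊆B , isBase = base-extending M {C} {S ∪ C} (q⊆p∪q S C) (⊆-indep C⊆O indO)
    in ≤-trans (fromℕ-mono-≤ (p⊆q⇒∣p∣≤∣q∣ C⊆B)) (isP (S ∪ C) B S isBase S-isBase)
    where
    C = captured M O S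
    ∈C⇒Captured : ∀ {e} → e ∈ C → Captured M O S e
    ∈C⇒Captured = ∈-comprehension⁻ (captured? M O S)
    C⊆O : C ⊆ O
    C⊆O = proj₁ ∘ ∈C⇒Captured
    S-isBase : IsBase S (S ∪ C)
    S-isBase = p⊆p∪q C , indS , λ x x∈S∪C x∉S →
      [ (λ x∈S → contradiction x∈S x∉S)
      , (λ x∈C → [ (λ x∈S → contradiction x∈S x∉S) , id ]′ (proj₂ (∈C⇒Captured x∈C)))
      ]′ (x∈p∪q⁻ S C x∈S∪C)

-- Indicator functions and submodularity

module Indicator (ℝ : Reals) where
  open Reals ℝ
  open OrderedField ℝ
  open CommutativeRing commutativeRing using (+-identityˡ; +-congˡ; +-commutativeMonoid)
    renaming (refl to ≈-refl; trans to ≈-trans)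
  open Sum +-commutativeMonoid using (sum) public

  -- The indicator function of a subset.
  χ : ∀ {n} → Subset n → Fin n → Carrier
  χ X e = if lookup X e then 1# else 0#

  χ-∈ : ∀ {n} {X : Subset n} {e} → e ∈ X → χ X e ≡ 1#
  χ-∈ e∈X rewrite []=⇒lookup e∈X = refl

  χ-∉ : ∀ {n} {X : Subset n} {e} → e ∉ X → χ X e ≡ 0#
  χ-∉ {X = X} {e} e∉X with lookup X e in eq
  ... | true  = contradiction (lookup⇒[]= e X eq) e∉X
  ... | false = refl

  χ-nonNeg : ∀ {n} (X : Subset n) e → 0# ≤ χ X e
  χ-nonNeg X e with lookup X e
  ... | true  = 0≤1
  ... | false = ≤-refl

  χ-mono : ∀ {n} {X Y : Subset n} {e} → (e ∈ X → e ∈ Y) → χ X e ≤ χ Y e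
  χ-mono {X = X} {Y} {e} X⊆Y with e ∈? X
  ... | yes e∈X = ≡⇒≤ (≡.trans (χ-∈ e∈X) (≡.sym (χ-∈ (X⊆Y e∈X))))
  ... | no  e∉X = ≡.subst (_≤ χ Y e) (≡.sym (χ-∉ e∉X)) (χ-nonNeg Y e)

  sum-χ : ∀ {n} (X : Subset n) → sum (χ X) ≈ fromℕ ∣ X ∣
  sum-χ []            = ≈-refl
  sum-χ (inside  ∷ X) = +-congˡ (sum-χ X)
  sum-χ (outside ∷ X) = ≈-trans (+-identityˡ _) (sum-χ X)

  sum-mono : ∀ {n} {g h : Fin n → Carrier} → (∀ i → g i ≤ h i) → sum g ≤ sum h
  sum-mono {zero}  g≤h = ≤-refl
  sum-mono {suc n} g≤h = +-mono-≤ (g≤h zero) (sum-mono (g≤h ∘ suc))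

module SubmodularFunction (ℝ : Reals) {n : ℕ} (f : Subset n → Reals.Carrier ℝ)
                          (submodular : Submodular ℝ f) where
  open Reals ℝ using (Carrier; _≤_; _+_; commutativeRing; 0#; +-monoˡ-≤)
  open OrderedField ℝ
  open Indicator ℝ using (sum)
  open CommutativeRing commutativeRing using (commutativeSemiring; +-identityʳ)
    renaming (refl to ≈-refl; sym to ≈-sym)
  open NaturalSolver commutativeSemiring using (solve; _:+_; _:=_)
  open PosetReasoning ≤-poset

  -- Diminishing marginal gains, f (e | S′) ≤ f (e | S), in subtraction-free form.
  diminishing : ∀ {S S′ e} → S ⊆ S′ → e ∉ S′ → f (S′ ∪ ⁅ e ⁆) + f S ≤ f S′ + f (S ∪ ⁅ e ⁆)
  diminishing {S} {S′} {e} S⊆S′ e∉S′ =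
    ≡.subst₂ (λ A B → f A + f B ≤ f S′ + f (S ∪ ⁅ e ⁆)) union intersection (submodular S′ (S ∪ ⁅ e ⁆))
    where
    union : S′ ∪ (S ∪ ⁅ e ⁆) ≡ S′ ∪ ⁅ e ⁆
    union = ⊆-antisym (∪-⊆ (p⊆p∪q _) (∪-mono-⊆ S⊆S′ id)) (∪-mono-⊆ id (q⊆p∪q S _))
    intersection : S′ ∩ (S ∪ ⁅ e ⁆) ≡ S
    intersection = ⊆-antisym
      (λ x∈ → let x∈S′ , x∈Se = x∈p∩q⁻ S′ (S ∪ ⁅ e ⁆) x∈ in
        [ id , (λ { refl → contradiction x∈S′ e∉S′ }) ]′ (∈-∪⁅⁆⁻ x∈Se))
      (λ x∈S → x∈p∩q⁺ (S⊆S′ x∈S , p⊆p∪q _ x∈S))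

  diminishing-≤ : ∀ {S S′ e c} → S ⊆ S′ → e ∉ S′ →
    f (S ∪ ⁅ e ⁆) ≤ f S + c → f (S′ ∪ ⁅ e ⁆) ≤ f S′ + c
  diminishing-≤ S⊆S′ e∉S′ = gain-trans (diminishing S⊆S′ e∉S′)

  private
    -- The elements of X are added to S one at a time, in the order in which h enumerates them.  Terms
    -- h i outside X or in S do no harm, because their g-values are non-negative.
    gains-from : ∀ {S} {g : Fin n → Carrier} → (∀ e → 0# ≤ g e) →
      ∀ {m} (h : Fin m → Fin n) X → (∀ {e} → e ∈ X → ∃[ i ] h i ≡ e) →
      (∀ {e} → e ∈ X → f (S ∪ ⁅ e ⁆) ≤ f S + g e) → f (S ∪ X) ≤ f S + sum (g ∘ h)
    gains-from {S} 0≤g {zero} h X cover bound = ≤-trans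
      (≡⇒≤ (≡.cong f (⊆-antisym (∪-⊆ id (λ x∈X → contradiction (proj₁ (cover x∈X)) λ ())) (p⊆p∪q X))))
      (≤-reflexive (≈-sym (+-identityʳ _)))
    gains-from {S} {g} 0≤g {suc m} h X cover bound = begin
      f (S ∪ X)
        ≤⟨ step ⟩
      f (S ∪ X′) + g e
        ≤⟨ +-monoˡ-≤ (g e) (gains-from 0≤g (h ∘ suc) X′ cover′ (bound ∘ X′⊆X)) ⟩
      f S + sum (g ∘ h ∘ suc) + g e
        ≈⟨ solve 3 (λ a b c → a :+ b :+ c := a :+ (c :+ b)) ≈-refl (f S) _ (g e) ⟩
      f S + sum (g ∘ h) ∎
      where
      e = h zero
      X′ = X ∖ e
      X′⊆X : X′ ⊆ X
      X′⊆X = p─q⊆p X ⁅ e ⁆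
      ∈X⇒ : ∀ {x} → x ∈ X → x ∈ X′ ⊎ x ≡ e
      ∈X⇒ {x} x∈X with x Fin.≟ e
      ... | yes x≡e = inj₂ x≡e
      ... | no  x≢e = inj₁ (x∈p∧x≢y⇒x∈p-y x∈X x≢e)
      cover′ : ∀ {x} → x ∈ X′ → ∃[ i ] h (suc i) ≡ x
      cover′ x∈X′ with cover (X′⊆X x∈X′)
      ... | zero  , refl = contradiction x∈X′ (x∉p∖x X e)
      ... | suc i , eq   = i , eq
      S∪X≡ : e ∈ X → S ∪ X ≡ (S ∪ X′) ∪ ⁅ e ⁆
      S∪X≡ e∈X = ⊆-antisym
        (∪-⊆ (p⊆p∪q _ ∘ p⊆p∪q _)
             (λ x∈X → [ p⊆p∪q _ ∘ q⊆p∪q S X′ , (λ { refl → e∈A∪⁅e⁆ }) ]′ (∈X⇒ x∈X)))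
        (∪-⊆ (∪-mono-⊆ id X′⊆X) (⁅⁆-⊆ (q⊆p∪q S X e∈X)))
      same : S ∪ X ≡ S ∪ X′ → f (S ∪ X) ≤ f (S ∪ X′) + g e
      same eq = ≤-trans (≡⇒≤ (≡.cong f eq)) (x≤x+y (0≤g e))
      step : f (S ∪ X) ≤ f (S ∪ X′) + g e
      step with e ∈? X | e ∈? S
      ... | no e∉X | _ = same (⊆-antisym
        (∪-mono-⊆ id λ x∈X → [ id , (λ { refl → contradiction x∈X e∉X }) ]′ (∈X⇒ x∈X))
        (∪-mono-⊆ id X′⊆X))
      ... | yes e∈X | yes e∈S = same (≡.trans (S∪X≡ e∈X) (∪⁅⁆-absorb (p⊆p∪q _ e∈S)))
      ... | yes e∈X | no e∉S = ≡.subst (λ A → f A ≤ f (S ∪ X′) + g e) (≡.sym (S∪X≡ e∈X))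
        (diminishing-≤ (p⊆p∪q X′) (λ e∈ → [ e∉S , x∉p∖x X e ]′ (x∈p∪q⁻ S X′ e∈)) (bound e∈X))

  -- The gain of a set is at most the sum of the gains of its elements.
  union-gain : ∀ {S X} {g : Fin n → Carrier} → (∀ e → 0# ≤ g e) →
    (∀ {e} → e ∈ X → f (S ∪ ⁅ e ⁆) ≤ f S + g e) → f (S ∪ X) ≤ f S + sum g
  union-gain 0≤g = gains-from 0≤g id _ (λ {e} _ → e , refl)

-- Oracle programs

unique-length : ∀ {n} {es : List (Fin n)} → Unique es → length es ℕ.≤ n
unique-length unique = Fin.injective⇒≤ (lookup-injective unique)
  where
  lookup-injective : ∀ {A : Set} {xs : List A} → Unique xs →
    ∀ {i j} → List.lookup xs i ≡ List.lookup xs j → i ≡ j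
  lookup-injective (_  ∷ _) {zero}  {zero}  _  = refl
  lookup-injective (x∉ ∷ _) {zero}  {suc j} eq = contradiction eq (All.lookup x∉ (∈-lookup j))
  lookup-injective (x∉ ∷ _) {suc i} {zero}  eq = contradiction (≡.sym eq) (All.lookup x∉ (∈-lookup i))
  lookup-injective (_  ∷ u) {suc i} {suc j} eq = ≡.cong suc (lookup-injective u eq)

module Queries (ℝ : Reals) {n : ℕ} (M : IndependenceSystem n) (f : Subset n → Reals.Carrier ℝ) where
  open Reals ℝ
  open OrderedField ℝ
  open IndependenceSystem M
  open CommutativeRing commutativeRing using (+-comm; +-assoc; +-congˡ; +-congʳ)
  open PosetReasoning ≤-poset
  open AddInfimum _≤_ using (_≤₋_; ≤₋-trans; ≤₋-total; [≤]-injective)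

  -- The program q returns the value a after at most c oracle queries.
  record Returns {A : Set} (q : Prog ℝ A) (a : A) (c : ℕ) : Set where
    constructor returns
    field
      {queries} : ℕ
      run≡      : run ℝ M f q ≡ (a , queries)
      queries≤  : queries ℕ.≤ c

  returns-≤ : ∀ {A : Set} {q : Prog ℝ A} {a c d} → c ℕ.≤ d → Returns q a c → Returns q a d
  returns-≤ c≤d (returns eq t≤c) = returns eq (ℕ.≤-trans t≤c c≤d)

  returns-return : ∀ {A : Set} {a : A} {c} → Returns (return a) a c
  returns-return = returns refl ℕ.z≤n

  run->>= : ∀ {A B : Set} (q : Prog ℝ A) (g : A → Prog ℝ B) {a t} → run ℝ M f q ≡ (a , t) →
            run ℝ M f (_>>=_ ℝ q g) ≡ map₂ (t ℕ.+_) (run ℝ M f (g a))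
  run->>= (return a)   g refl = refl
  run->>= (value X k)  g refl = ≡.cong (map₂ suc) (run->>= (k (f X)) g refl)
  run->>= (member X k) g refl = ≡.cong (map₂ suc) (run->>= (k (does (independent? X))) g refl)

  returns->>= : ∀ {A B : Set} {q : Prog ℝ A} {g : A → Prog ℝ B} {a b c d} →
    Returns q a c → Returns (g a) b d → Returns (_>>=_ ℝ q g) b (c ℕ.+ d)
  returns->>= {q = q} {g} (returns eq t≤c) (returns eq′ u≤d) =
    returns (≡.trans (run->>= q g eq) (≡.cong (map₂ _) eq′)) (ℕ.+-mono-≤ t≤c u≤d)

  returns-value : ∀ {A : Set} {X} {k : Carrier → Prog ℝ A} {a c} →
    Returns (k (f X)) a c → Returns (value X k) a (suc c)
  returns-value (returns eq t≤c) = returns (≡.cong (map₂ suc) eq) (ℕ.s≤s t≤c)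

  returns-member : ∀ {A : Set} {X} {k : Bool → Prog ℝ A} {a b c} →
    Returns (k true) a c → Returns (k false) b c →
    Returns (member X k) (if does (independent? X) then a else b) (suc c)
  returns-member {X = X} {k} (returns eq t≤c) (returns eq′ u≤c) with does (independent? X) in b≡
  ... | true  = returns (≡.cong (map₂ suc) (≡.trans (≡.cong (run ℝ M f ∘ k) b≡) eq)) (ℕ.s≤s t≤c)
  ... | false = returns (≡.cong (map₂ suc) (≡.trans (≡.cong (run ℝ M f ∘ k) b≡) eq′)) (ℕ.s≤s u≤c)

  -- The marginal gain f (e | S), or -∞ if S cannot be enlarged by e.
  Δ : Fin n → Subset n → Carrier₋ ℝ {n}
  Δ e S = if does (independent? (S ∪ ⁅ e ⁆)) then [ f (S ∪ ⁅ e ⁆) - f S ] else ⊥₋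

  gain-returns : ∀ e S → Returns (gain ℝ e S) (Δ e S) 3
  gain-returns e S =
    returns-member (returns-value (returns-value (returns-return {c = 0}))) returns-return

  Δ-≤ : ∀ {e S v} → Δ e S ≤₋ [ v ] → Independent (S ∪ ⁅ e ⁆) → f (S ∪ ⁅ e ⁆) - f S ≤ v
  Δ-≤ {e} {S} h ind with independent? (S ∪ ⁅ e ⁆)
  ... | yes _  = [≤]-injective h
  ... | no dep = contradiction ind dep

  ≤-Δ : ∀ {e S v} → [ v ] ≤₋ Δ e S → Independent (S ∪ ⁅ e ⁆) × v ≤ f (S ∪ ⁅ e ⁆) - f S
  ≤-Δ {e} {S} h with independent? (S ∪ ⁅ e ⁆)
  ... | yes ind = ind , [≤]-injective h
  ≤-Δ () | no _

  Δ-indep : ∀ {e S} → Independent (S ∪ ⁅ e ⁆) → Δ e S ≡ [ f (S ∪ ⁅ e ⁆) - f S ]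
  Δ-indep {e} {S} ind with independent? (S ∪ ⁅ e ⁆)
  ... | yes _  = refl
  ... | no dep = contradiction ind dep

  -- What a visit of v at threshold τ can do to the state (S , T), with the comparisons of marginal
  -- gains that it certifies.  The inequality f T′ + f S ≤ f T + f S′ for T′ and S′ the sets enlarged
  -- by v says that the gain of v for T is at most its gain for S.
  data Outcome (τ : Carrier) (v : Fin n) (S T : Subset n) : State ℝ → Set where
    rejected : (Independent (S ∪ ⁅ v ⁆) → f (S ∪ ⁅ v ⁆) ≤ f S + τ) →
               (Independent (T ∪ ⁅ v ⁆) → f (T ∪ ⁅ v ⁆) ≤ f T + τ) →
               Outcome τ v S T (S , T)
    inserted₁ : Independent (S ∪ ⁅ v ⁆) → f S + τ ≤ f (S ∪ ⁅ v ⁆) →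
                (Independent (T ∪ ⁅ v ⁆) → f (T ∪ ⁅ v ⁆) + f S ≤ f T + f (S ∪ ⁅ v ⁆)) →
                Outcome τ v S T (S ∪ ⁅ v ⁆ , T)
    inserted₂ : Independent (T ∪ ⁅ v ⁆) → f T + τ ≤ f (T ∪ ⁅ v ⁆) →
                (Independent (S ∪ ⁅ v ⁆) → f (S ∪ ⁅ v ⁆) + f T ≤ f S + f (T ∪ ⁅ v ⁆)) →
                Outcome τ v S T (S , T ∪ ⁅ v ⁆)

  argmax-first : ∀ t x y → argmax ℝ {n} t x y ≡ first → y ≤₋ x
  argmax-first t x y eq with _≤₋?_ ℝ {n} x y | _≤₋?_ ℝ {n} y x
  ... | yes _  | yes y≤x = y≤x
  argmax-first t x y () | yes _ | no _
  ... | no x≰y | _ = [ (λ x≤y → contradiction x≤y x≰y) , id ]′ (≤₋-total ≤-total x y)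

  argmax-second : ∀ t x y → argmax ℝ {n} t x y ≡ second → x ≤₋ y
  argmax-second t x y eq with _≤₋?_ ℝ {n} x y | _≤₋?_ ℝ {n} y x
  ... | yes x≤y | _ = x≤y
  argmax-second t x y () | no _ | _

  ≤₋-refl : ∀ {x} → x ≤₋ x
  ≤₋-refl {x} = [ id , id ]′ (≤₋-total ≤-total x x)

  ≰₋⇒≥₋ : ∀ {x y} → ¬ (x ≤₋ y) → y ≤₋ x
  ≰₋⇒≥₋ {x} {y} x≰y = [ (λ x≤y → contradiction x≤y x≰y) , id ]′ (≤₋-total ≤-total x y)

  private
    upper : ∀ {τ v S} → Δ v S ≤₋ [ τ ] → Independent (S ∪ ⁅ v ⁆) → f (S ∪ ⁅ v ⁆) ≤ f S + τ
    upper Δ≤τ ind = ≤-trans (difference-≤⁻¹ (Δ-≤ Δ≤τ ind)) (≤-reflexive (+-comm _ _))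

    lower : ∀ {τ v S} → [ τ ] ≤₋ Δ v S → Independent (S ∪ ⁅ v ⁆) × f S + τ ≤ f (S ∪ ⁅ v ⁆)
    lower τ≤Δ = let ind , τ≤ = ≤-Δ τ≤Δ in
      ind , ≤-trans (≤-reflexive (+-comm _ _)) (≤-difference⁻¹ τ≤)

    compare : ∀ {v S T} → Δ v T ≤₋ Δ v S → Independent (S ∪ ⁅ v ⁆) → Independent (T ∪ ⁅ v ⁆) →
      f (T ∪ ⁅ v ⁆) + f S ≤ f T + f (S ∪ ⁅ v ⁆)
    compare {v} {S} {T} Δ≤Δ indS indT = begin
      f (T ∪ ⁅ v ⁆) + f S             ≤⟨ +-monoˡ-≤ (f S) (difference-≤⁻¹ ΔT≤ΔS) ⟩
      f (S ∪ ⁅ v ⁆) - f S + f T + f S ≈⟨ +-assoc _ _ _ ⟩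
      f (S ∪ ⁅ v ⁆) - f S + (f T + f S) ≈⟨ +-congˡ (+-comm _ _) ⟩
      f (S ∪ ⁅ v ⁆) - f S + (f S + f T) ≈⟨ +-assoc _ _ _ ⟨
      f (S ∪ ⁅ v ⁆) - f S + f S + f T ≈⟨ +-congʳ (x-z+z≈x _ _) ⟩
      f (S ∪ ⁅ v ⁆) + f T             ≈⟨ +-comm _ _ ⟩
      f T + f (S ∪ ⁅ v ⁆)             ∎
      where
      ΔT≤ΔS : f (T ∪ ⁅ v ⁆) - f T ≤ f (S ∪ ⁅ v ⁆) - f S
      ΔT≤ΔS = [≤]-injective (≡.subst₂ _≤₋_ (Δ-indep indT) (Δ-indep indS) Δ≤Δ)

  insertion-outcome : ∀ τ v t S T →
    Outcome τ v S T (insert ℝ τ v (argmax ℝ {n} t (Δ v S) (Δ v T)) (Δ v S) (Δ v T) (S , T))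
  insertion-outcome τ v t S T with argmax ℝ {n} t (Δ v S) (Δ v T) in eq
  insertion-outcome τ v t S T | first with _≤₋?_ ℝ {n} [ τ ] (Δ v S)
  ... | yes τ≤Δ = let ind , τ≤ = lower τ≤Δ in
    inserted₁ ind τ≤ (compare (argmax-first t _ _ eq) ind)
  ... | no τ≰Δ = rejected (upper (≰₋⇒≥₋ τ≰Δ))
    (upper (≤₋-trans ≤-trans (argmax-first t _ _ eq) (≰₋⇒≥₋ τ≰Δ)))
  insertion-outcome τ v t S T | second with _≤₋?_ ℝ {n} [ τ ] (Δ v T)
  ... | yes τ≤Δ = let ind , τ≤ = lower τ≤Δ in
    inserted₂ ind τ≤ (compare (argmax-second t _ _ eq) ind)
  ... | no τ≰Δ = rejected (upper (≤₋-trans ≤-trans (argmax-second t _ _ eq) (≰₋⇒≥₋ τ≰Δ)))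
    (upper (≰₋⇒≥₋ τ≰Δ))

  visit-returns : ∀ τ v t S T → ∃[ s ] Returns (visit ℝ τ v t (S , T)) s 6 × Outcome τ v S T s
  visit-returns τ v t S T = _ ,
    returns->>= (gain-returns v S) (returns->>= (gain-returns v T) (returns-return {c = 0})) ,
    insertion-outcome τ v t S T

  -- The running maximum m after the singleton of e has been examined.
  singletonMax : Fin n → Carrier₋ ℝ {n} → Carrier₋ ℝ {n}
  singletonMax e m = if does (independent? ⁅ e ⁆) then max₋ ℝ {n} [ f ⁅ e ⁆ ] m else m

  singletonMax-upper : ∀ e m →
    m ≤₋ singletonMax e m × (Independent ⁅ e ⁆ → [ f ⁅ e ⁆ ] ≤₋ singletonMax e m)
  singletonMax-upper e m with independent? ⁅ e ⁆
  ... | no dep = ≤₋-refl , λ ind → contradiction ind dep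
  ... | yes _ with _≤₋?_ ℝ {n} [ f ⁅ e ⁆ ] m
  ...   | yes fe≤m = ≤₋-refl , λ _ → fe≤m
  ...   | no  fe≰m = ≰₋⇒≥₋ fe≰m , λ _ → ≤₋-refl

  -- If m is finite, it is the value of an independent singleton.
  Attained : Carrier₋ ℝ {n} → Set
  Attained m = ∀ {τ} → m ≡ [ τ ] → ∃[ e ] Independent ⁅ e ⁆ × f ⁅ e ⁆ ≡ τ

  singletonMax-attained : ∀ e m → Attained m → Attained (singletonMax e m)
  singletonMax-attained e m attained with independent? ⁅ e ⁆
  ... | no _ = attained
  ... | yes ind with _≤₋?_ ℝ {n} [ f ⁅ e ⁆ ] m
  ...   | yes _ = attained
  ...   | no  _ = λ { refl → e , ind , refl }

  maxSingleton-returns : ∀ es → ∃[ m ] Returns (maxSingleton ℝ es) m (length es ℕ.* 2) ×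
    (∀ {e} → e List.∈ es → Independent ⁅ e ⁆ → [ f ⁅ e ⁆ ] ≤₋ m) × Attained m
  maxSingleton-returns []       = ⊥₋ , returns-return , (λ ()) , λ ()
  maxSingleton-returns (e ∷ es) =
    let m , rest , upper , attained = maxSingleton-returns es
        m≤ , fe≤ = singletonMax-upper e m
    in singletonMax e m ,
       returns-≤ (ℕ.≤-reflexive (ℕ.+-comm (length es ℕ.* 2) 2))
         (returns->>= rest (returns-member (returns-value (returns-return {c = 0})) returns-return)) ,
       (λ { (here refl) → fe≤ ; (there e∈es) ind → ≤₋-trans ≤-trans (upper e∈es ind) m≤ }) ,
       singletonMax-attained e m attained

-- The invariant of the algorithm

module Analysis (ℝ : Reals) {n : ℕ} (M : IndependenceSystem n)
  (p : Reals.Carrier ℝ) (0≤p : Reals._≤_ ℝ (Reals.0# ℝ) p) (isPSet : IsPSetSystem ℝ p M)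
  (f : Subset n → Reals.Carrier ℝ) (submodular : Submodular ℝ f) (nonNeg : NonNegative ℝ f)
  (ε : Reals.Carrier ℝ) (0<ε : Reals._<_ ℝ (Reals.0# ℝ) ε) where

  open Reals ℝ
  open OrderedField ℝ
  open Indicator ℝ
  open SubmodularFunction ℝ f submodular
  open IndependenceSystem M
  open Queries ℝ M f
  open CommutativeRing commutativeRing
    using (commutativeSemiring; +-commutativeMonoid; reflexive; +-identityˡ; +-identityʳ; +-comm
          ; *-assoc; *-identityˡ; *-identityʳ; +-cong; +-congˡ; +-congʳ; *-congˡ; *-congʳ
          ; distribˡ)
    renaming (refl to ≈-refl; sym to ≈-sym; trans to ≈-trans)
  open NaturalSolver commutativeSemiring using (solve; _:+_; _:*_; _:=_; con)
  open Sum +-commutativeMonoid using (∑-distrib-+)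
  open SemiringSum semiring using (*-distribˡ-sum)
  open PosetReasoning ≤-poset

  0≤ε : 0# ≤ ε
  0≤ε = <⇒≤ 0<ε

  0<1+ε : 0# < 1# + ε
  0<1+ε = <-≤-trans 0<1 (x≤x+y 0≤ε)

  0≤1+ε : 0# ≤ 1# + ε
  0≤1+ε = <⇒≤ 0<1+ε

  -- What an element e of O costs S when its credit is x e: the credit, and additionally the current
  -- threshold τ if e is captured.
  charge : Subset n → Carrier → (Fin n → Carrier) → Subset n → Fin n → Carrier
  charge O τ x S e = x e + τ * χ (captured M O S) e

  -- The account of S at threshold τ, relative to an independent set O and to the credits x for S and
  -- y for T.  The credits change only when the threshold does.  The last two fields bound the gain
  -- f (e | S) of an element e of O.
  record Account (O : Subset n) (τ : Carrier) (x y : Fin n → Carrier) (S T : Subset n) : Set where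
    field
      credit-nonNeg : ∀ e → 0# ≤ x e
      -- The value gained since the start, taken p times, pays for all credits and, for each element
      -- of S, for p captured elements at the current threshold.
      budget        : sum x + τ * (p * fromℕ ∣ S ∣) + p * f ⊥ ≤ p * f S
      gain-outside  : ∀ {e} → e ∈ O → e ∉ S → e ∉ T →
                      f (S ∪ ⁅ e ⁆) ≤ f S + (1# + ε) * (x e + τ)
      gain-other    : ∀ {e} → e ∈ O → e ∈ T →
                      f (S ∪ ⁅ e ⁆) ≤ f S + (1# + ε) * (charge O τ x S e + charge O τ y T e)
  open Account

  -- Accounts of both sets, each referring to the credits of the other.
  record Accounts (τ : Carrier) (S T : Subset n) (O : Subset n) : Set where
    constructor accounts
    field
      {creditS creditT} : Fin n → Carrier
      accountS : Account O τ creditS creditT S T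
      accountT : Account O τ creditT creditS T S

  -- The state (S , T) at threshold τ.  The accounts are kept for every independent set O, since the
  -- algorithm does not know an optimal one.
  record Invariant (τ : Carrier) (S T : Subset n) : Set where
    constructor invariant
    field
      indS     : Independent S
      indT     : Independent T
      disjoint : ∀ {e} → e ∈ S → e ∉ T
      credit   : ∀ {O} → Independent O → Accounts τ S T O

  swap-Invariant : ∀ {τ S T} → Invariant τ S T → Invariant τ T S
  swap-Invariant (invariant indS indT disjoint credit) =
    invariant indT indS (λ e∈T e∈S → disjoint e∈S e∈T) λ indO →
      let accounts hS hT = credit indO in accounts hT hS

  -- Every element outside S and T that the current pass has already visited (those in rest are still
  -- to come) has a gain of at most τ for S, unless S cannot be enlarged by it.
  Rejected : Carrier → Subset n → Subset n → List (Fin n) → Set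
  Rejected τ S T rest = ∀ {e} → e ∉ S → e ∉ T → ¬ (e List.∈ rest) →
    Independent (S ∪ ⁅ e ⁆) → f (S ∪ ⁅ e ⁆) ≤ f S + τ

  charge-mono : ∀ {O τ x S S′} → 0# ≤ τ → S ⊆ S′ → ∀ e → charge O τ x S e ≤ charge O τ x S′ e
  charge-mono {O} {x = x} {S} {S′} 0≤τ S⊆S′ e = +-monoʳ-≤ (x e) (*-monoˡ-≤ 0≤τ (χ-mono
    (∈-comprehension⁺ (captured? M O S′) ∘ Captured-mono M S⊆S′ ∘ ∈-comprehension⁻ (captured? M O S))))

  charge-captured : ∀ {O τ x S e} → Captured M O S e → charge O τ x S e ≈ x e + τ
  charge-captured {O} {τ} {x} {S} {e} captured-e
    rewrite χ-∈ (∈-comprehension⁺ (captured? M O S) captured-e) = +-congˡ (*-identityʳ τ)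

  charge-nonNeg : ∀ {O τ x S} → 0# ≤ τ → (∀ e → 0# ≤ x e) → ∀ e → 0# ≤ charge O τ x S e
  charge-nonNeg {O} {S = S} 0≤τ 0≤x e = +-nonNeg (0≤x e) (*-nonNeg 0≤τ (χ-nonNeg (captured M O S) e))

  sum-charge : ∀ {O τ} x S → sum (charge O τ x S) ≈ sum x + τ * fromℕ ∣ captured M O S ∣
  sum-charge {O} {τ} x S = begin-equality
    sum (charge O τ x S)          ≈⟨ ∑-distrib-+ x (λ e → τ * χ C e) ⟩
    sum x + sum (λ e → τ * χ C e) ≈⟨ +-congˡ (*-distribˡ-sum τ (χ C)) ⟨
    sum x + τ * sum (χ C)         ≈⟨ +-congˡ (*-congˡ (sum-χ C)) ⟩
    sum x + τ * fromℕ ∣ C ∣       ∎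
    where C = captured M O S

  relax : ∀ {A b c d} → 0# ≤ A → b ≤ c + A * d → ∀ {d′} → d ≤ d′ → b ≤ c + A * d′
  relax 0≤A h d≤d′ = ≤-trans h (+-monoʳ-≤ _ (*-monoˡ-≤ 0≤A d≤d′))

  -- The insertion of v into S, at a gain of at least τ.  By the choice of S, the gain of v for S is
  -- at least its gain for T, unless T cannot be enlarged by v.
  insert-Invariant : ∀ {τ S T v} → 0# ≤ τ → Invariant τ S T → v ∉ S → v ∉ T →
    Independent (S ∪ ⁅ v ⁆) → f S + τ ≤ f (S ∪ ⁅ v ⁆) →
    (Independent (T ∪ ⁅ v ⁆) → f (T ∪ ⁅ v ⁆) + f S ≤ f T + f (S ∪ ⁅ v ⁆)) →
    Invariant τ (S ∪ ⁅ v ⁆) T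
  insert-Invariant {τ} {S} {T} {v} 0≤τ (invariant indS indT disjoint credit) v∉S v∉T
    ind τ≤gain better =
    invariant ind indT disjoint′ λ indO →
      let accounts hS hT = credit indO in accounts (account₁ hS) (account₂ hS hT)
    where
    S′ = S ∪ ⁅ v ⁆
    S⊆S′ : S ⊆ S′
    S⊆S′ = p⊆p∪q ⁅ v ⁆
    disjoint′ : ∀ {e} → e ∈ S′ → e ∉ T
    disjoint′ e∈S′ with ∈-∪⁅⁆⁻ e∈S′
    ... | inj₁ e∈S  = disjoint e∈S
    ... | inj₂ refl = v∉T

    account₁ : ∀ {O x y} → Account O τ x y S T → Account O τ x y S′ T
    account₁ {O} {x} {y} h = record
      { credit-nonNeg = credit-nonNeg h
      ; budget = begin
          sum x + τ * (p * fromℕ ∣ S′ ∣) + p * f ⊥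
            ≤⟨ +-monoˡ-≤ _ (+-monoʳ-≤ (sum x) (*-monoˡ-≤ 0≤τ (*-monoˡ-≤ 0≤p
                 (fromℕ-mono-≤ (∣A∪⁅e⁆∣≤1+∣A∣ S v))))) ⟩
          sum x + τ * (p * (1# + fromℕ ∣ S ∣)) + p * f ⊥
            ≈⟨ solve 5 (λ s t p k g → s :+ t :* (p :* (con 1 :+ k)) :+ g
                                   := (s :+ t :* (p :* k) :+ g) :+ p :* t) ≈-refl
                 (sum x) τ p (fromℕ ∣ S ∣) (p * f ⊥) ⟩
          sum x + τ * (p * fromℕ ∣ S ∣) + p * f ⊥ + p * τ
            ≤⟨ +-monoˡ-≤ _ (budget h) ⟩
          p * f S + p * τ
            ≈⟨ distribˡ p (f S) τ ⟨
          p * (f S + τ)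
            ≤⟨ *-monoˡ-≤ 0≤p τ≤gain ⟩
          p * f S′ ∎
      ; gain-outside = λ e∈O e∉S′ e∉T → diminishing-≤ S⊆S′ e∉S′ (gain-outside h e∈O (e∉S′ ∘ S⊆S′) e∉T)
      ; gain-other = λ {e} e∈O e∈T → relax 0≤1+ε
          (diminishing-≤ S⊆S′ (λ e∈S′ → disjoint′ e∈S′ e∈T) (gain-other h e∈O e∈T))
          (+-monoˡ-≤ _ (charge-mono {O} {x = x} 0≤τ S⊆S′ e))
      }

    account₂ : ∀ {O x y} → Account O τ x y S T → Account O τ y x T S → Account O τ y x T S′
    account₂ {O} {x} {y} hS hT = record
      { credit-nonNeg = credit-nonNeg hT
      ; budget = budget hT
      ; gain-outside = λ e∈O e∉T e∉S′ → gain-outside hT e∈O e∉T (e∉S′ ∘ S⊆S′)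
      ; gain-other   = gain-other′
      }
      where
      -- If T can be enlarged by v, then S pays for v, which it now captures; otherwise T captures v
      -- and pays itself.
      gain-other-v : v ∈ O → f (T ∪ ⁅ v ⁆) ≤ f T + (1# + ε) * (charge O τ y T v + charge O τ x S′ v)
      gain-other-v v∈O with independent? (T ∪ ⁅ v ⁆)
      ... | yes indTv = ≤-trans
        (gain-trans (better indTv) (gain-outside hS v∈O v∉S v∉T))
        (+-monoʳ-≤ (f T) (*-monoˡ-≤ 0≤1+ε (≤-trans
          (≤-reflexive (≈-sym (charge-captured {x = x} (v∈O , inj₁ e∈A∪⁅e⁆))))
          (x≤y+x (charge-nonNeg {O} {S = T} 0≤τ (credit-nonNeg hT) v)))))
      ... | no depTv = relax 0≤1+ε (gain-outside hT v∈O v∉T v∉S) (≤-trans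
          (≤-reflexive (≈-sym (charge-captured {x = y} (v∈O , inj₂ depTv))))
          (x≤x+y (charge-nonNeg {O} {S = S′} 0≤τ (credit-nonNeg hS) v)))

      gain-other′ : ∀ {e} → e ∈ O → e ∈ S′ →
        f (T ∪ ⁅ e ⁆) ≤ f T + (1# + ε) * (charge O τ y T e + charge O τ x S′ e)
      gain-other′ {e} e∈O e∈S′ with ∈-∪⁅⁆⁻ e∈S′
      ... | inj₁ e∈S  = relax 0≤1+ε (gain-other hT e∈O e∈S)
        (+-monoʳ-≤ _ (charge-mono {O} {x = x} 0≤τ S⊆S′ e))
      ... | inj₂ refl = gain-other-v e∈O

  Rejected-reject : ∀ {τ S T v rest} → Rejected τ S T (v ∷ rest) →
    (Independent (S ∪ ⁅ v ⁆) → f (S ∪ ⁅ v ⁆) ≤ f S + τ) → Rejected τ S T rest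
  Rejected-reject {v = v} seen small {e} e∉S e∉T e∉rest with e Fin.≟ v
  ... | yes refl = small
  ... | no  e≢v  = seen e∉S e∉T λ { (here e≡v) → e≢v e≡v ; (there e∈) → e∉rest e∈ }

  Rejected-insertₛ : ∀ {τ S T v rest} → Rejected τ S T (v ∷ rest) → Rejected τ (S ∪ ⁅ v ⁆) T rest
  Rejected-insertₛ {v = v} seen {e} e∉S′ e∉T e∉rest ind = diminishing-≤ (p⊆p∪q _) e∉S′
    (seen (e∉S′ ∘ p⊆p∪q _) e∉T
      (λ { (here refl) → e∉S′ e∈A∪⁅e⁆ ; (there e∈) → e∉rest e∈ })
      (⊆-indep (∪-mono-⊆ (p⊆p∪q _) id) ind))

  Rejected-insertₜ : ∀ {τ S T v rest} → Rejected τ S T (v ∷ rest) → Rejected τ S (T ∪ ⁅ v ⁆) rest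
  Rejected-insertₜ seen e∉S e∉T′ e∉rest = seen e∉S (e∉T′ ∘ p⊆p∪q _)
    (λ { (here refl) → e∉T′ e∈A∪⁅e⁆ ; (there e∈) → e∉rest e∈ })

  -- The state during a pass at threshold τ, with the elements of rest still to be visited.
  PassInvariant : Carrier → List (Fin n) → State ℝ → Set
  PassInvariant τ rest (S , T) = Invariant τ S T × Rejected τ S T rest × Rejected τ T S rest ×
    (∀ {e} → e List.∈ rest → e ∉ S × e ∉ T)

  visit-PassInvariant : ∀ {τ v rest S T s} → 0# ≤ τ → All (v ≢_) rest →
    PassInvariant τ (v ∷ rest) (S , T) → Outcome τ v S T s → PassInvariant τ rest s
  visit-PassInvariant 0≤τ v∉rest (I , seenS , seenT , fresh) (rejected rejS rejT) =
    I , Rejected-reject seenS rejS , Rejected-reject seenT rejT , fresh ∘ there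
  visit-PassInvariant 0≤τ v∉rest (I , seenS , seenT , fresh) (inserted₁ ind τ≤ better) =
    let v∉S , v∉T = fresh (here refl) in
    insert-Invariant 0≤τ I v∉S v∉T ind τ≤ better , Rejected-insertₛ seenS , Rejected-insertₜ seenT ,
    λ e∈ → let e∉S , e∉T = fresh (there e∈) in ∉-∪⁅⁆ e∉S (All.lookup v∉rest e∈ ∘ ≡.sym) , e∉T
  visit-PassInvariant 0≤τ v∉rest (I , seenS , seenT , fresh) (inserted₂ ind τ≤ better) =
    let v∉S , v∉T = fresh (here refl) in
    swap-Invariant (insert-Invariant 0≤τ (swap-Invariant I) v∉T v∉S ind τ≤ better) ,
    Rejected-insertₜ seenS , Rejected-insertₛ seenT ,
    λ e∈ → let e∉S , e∉T = fresh (there e∈) in e∉S , ∉-∪⁅⁆ e∉T (All.lookup v∉rest e∈ ∘ ≡.sym)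

  pass-returns : ∀ {τ} t rest s → 0# ≤ τ → Unique rest → PassInvariant τ rest s →
    ∃[ s′ ] Returns (pass ℝ τ t rest s) s′ (length rest ℕ.* 6) × PassInvariant τ [] s′
  pass-returns t []         s       0≤τ unique            I = s , returns-return , I
  pass-returns {τ} t (v ∷ rest) (S , T) 0≤τ (v∉rest ∷ unique) I =
    let s₁ , ret₁ , outcome = visit-returns τ v (t v) S T
        s₂ , ret₂ , I₂ = pass-returns t rest s₁ 0≤τ unique (visit-PassInvariant 0≤τ v∉rest I outcome)
    in s₂ , returns->>= ret₁ ret₂ , I₂

  -- When the threshold falls from τ to τ′, the credit of each captured element grows by the
  -- difference ε * τ′.  This leaves all charges as they were, and at most p * ∣ S ∣ elements are
  -- captured, so the budget still suffices.  An element of O outside both sets that S does not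
  -- capture was rejected during the pass.
  end-Account : ∀ {O τ τ′ x y S T} → 0# ≤ τ′ → τ ≈ (1# + ε) * τ′ → Independent O → Independent S →
    Rejected τ S T [] → Account O τ x y S T →
    Account O τ′ (charge O (ε * τ′) x S) (charge O (ε * τ′) y T) S T
  end-Account {O} {τ} {τ′} {x} {y} {S} {T} 0≤τ′ τ≈ indO indS seen h = record
    { credit-nonNeg = x′-nonNeg
    ; budget = begin
        sum x′ + τ′ * (p * fromℕ ∣ S ∣) + p * f ⊥
          ≈⟨ +-congʳ (+-congʳ (sum-charge x S)) ⟩
        sum x + ε * τ′ * fromℕ ∣ captured M O S ∣ + τ′ * (p * fromℕ ∣ S ∣) + p * f ⊥
          ≤⟨ +-monoˡ-≤ _ (+-monoˡ-≤ _ (+-monoʳ-≤ _ (*-monoˡ-≤ 0≤ετ′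
               (captured-bound ℝ M 0≤p isPSet indO indS)))) ⟩
        sum x + ε * τ′ * (p * fromℕ ∣ S ∣) + τ′ * (p * fromℕ ∣ S ∣) + p * f ⊥
          ≈⟨ solve 5 (λ s e t k g → s :+ e :* t :* k :+ t :* k :+ g
                                 := s :+ (con 1 :+ e) :* t :* k :+ g) ≈-refl
               (sum x) ε τ′ (p * fromℕ ∣ S ∣) (p * f ⊥) ⟩
        sum x + (1# + ε) * τ′ * (p * fromℕ ∣ S ∣) + p * f ⊥
          ≈⟨ +-congʳ (+-congˡ (*-congʳ τ≈)) ⟨
        sum x + τ * (p * fromℕ ∣ S ∣) + p * f ⊥
          ≤⟨ budget h ⟩
        p * f S ∎
    ; gain-outside = gain-outside′
    ; gain-other = λ {e} e∈O e∈T → relax 0≤1+ε (gain-other h e∈O e∈T)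
        (≤-reflexive (+-cong (same-charge x S e) (same-charge y T e)))
    }
    where
    0≤ετ′ = *-nonNeg 0≤ε 0≤τ′
    x′ : Fin n → Carrier
    x′ = charge O (ε * τ′) x S
    x′-nonNeg : ∀ e → 0# ≤ x′ e
    x′-nonNeg = charge-nonNeg {O} {S = S} 0≤ετ′ (credit-nonNeg h)
    split : ∀ a c → a + τ * c ≈ a + ε * τ′ * c + τ′ * c
    split a c = ≈-trans (+-congˡ (*-congʳ τ≈))
      (solve 4 (λ a c e t → a :+ (con 1 :+ e) :* t :* c := a :+ e :* t :* c :+ t :* c)
        ≈-refl a c ε τ′)
    same-charge : ∀ z U e → charge O τ z U e ≈ charge O τ′ (charge O (ε * τ′) z U) U e
    same-charge z U e = split (z e) (χ (captured M O U) e)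
    gain-outside′ : ∀ {e} → e ∈ O → e ∉ S → e ∉ T → f (S ∪ ⁅ e ⁆) ≤ f S + (1# + ε) * (x′ e + τ′)
    gain-outside′ {e} e∈O e∉S e∉T with independent? (S ∪ ⁅ e ⁆)
    ... | yes ind = begin
      f (S ∪ ⁅ e ⁆)          ≤⟨ seen e∉S e∉T (λ ()) ind ⟩
      f S + τ                ≈⟨ +-congˡ τ≈ ⟩
      f S + (1# + ε) * τ′    ≤⟨ +-monoʳ-≤ _ (*-monoˡ-≤ 0≤1+ε (x≤y+x (x′-nonNeg e))) ⟩
      f S + (1# + ε) * (x′ e + τ′) ∎
    ... | no dep = relax 0≤1+ε (gain-outside h e∈O e∉S e∉T) (begin
      x e + τ                             ≈⟨ charge-captured {x = x} captured-e ⟨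
      charge O τ x S e                    ≈⟨ same-charge x S e ⟩
      charge O τ′ x′ S e                  ≈⟨ charge-captured {x = x′} captured-e ⟩
      x′ e + τ′                           ∎)
      where
      captured-e : Captured M O S e
      captured-e = e∈O , inj₂ dep

  end-Invariant : ∀ {τ τ′ S T} → 0# ≤ τ′ → τ ≈ (1# + ε) * τ′ →
    PassInvariant τ [] (S , T) → Invariant τ′ S T
  end-Invariant 0≤τ′ τ≈ (invariant indS indT disjoint credit , seenS , seenT , _) =
    invariant indS indT disjoint λ indO → let accounts hS hT = credit indO in accounts
      (end-Account 0≤τ′ τ≈ indO indS seenS hS)
      (end-Account 0≤τ′ τ≈ indO indT seenT hT)

  -- Initially nothing is credited, and the gain of an independent singleton is at most τmax.
  start-Invariant : ∀ {τ} → 0# ≤ τ → (∀ {e} → Independent ⁅ e ⁆ → f ⁅ e ⁆ ≤ τ) → Invariant τ ⊥ ⊥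
  start-Invariant {τ} 0≤τ τ-max = invariant ⊥-indep ⊥-indep (λ e∈⊥ _ → ∉⊥ e∈⊥)
    λ indO → accounts (account indO) (account indO)
    where
    account : ∀ {O} → Independent O → Account O τ (λ _ → 0#) (λ _ → 0#) ⊥ ⊥
    account {O} indO = record
      { credit-nonNeg = λ _ → ≤-refl
      ; budget = ≤-reflexive (begin-equality
          sum {n} (λ _ → 0#) + τ * (p * fromℕ ∣ ⊥ {n} ∣) + p * f ⊥
            ≈⟨ +-congʳ (+-cong (Sum.sum-replicate-zero +-commutativeMonoid n)
                 (*-congˡ (*-congˡ (reflexive (≡.cong fromℕ (∣⊥∣≡0 n)))))) ⟩
          0# + τ * (p * 0#) + p * f ⊥
            ≈⟨ solve 3 (λ t p g → con 0 :+ t :* (p :* con 0) :+ g := g) ≈-refl τ p (p * f ⊥) ⟩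
          p * f ⊥ ∎)
      ; gain-outside = λ {e} e∈O _ _ → begin
          f (⊥ ∪ ⁅ e ⁆)
            ≡⟨ ≡.cong f (∪-identityˡ ⁅ e ⁆) ⟩
          f ⁅ e ⁆
            ≤⟨ τ-max (⊆-indep (⁅⁆-⊆ e∈O) indO) ⟩
          τ
            ≤⟨ x≤y+x (nonNeg ⊥) ⟩
          f ⊥ + τ
            ≤⟨ +-monoʳ-≤ _ (x≤x+y (*-nonNeg 0≤ε 0≤τ)) ⟩
          f ⊥ + (τ + ε * τ)
            ≈⟨ solve 3 (λ b t e → b :+ (t :+ e :* t) := b :+ (con 1 :+ e) :* (con 0 :+ t)) ≈-refl
                 (f ⊥) τ ε ⟩
          f ⊥ + (1# + ε) * (0# + τ) ∎
      ; gain-other = λ _ e∈⊥ → contradiction e∈⊥ ∉⊥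
      }

  module _ (choices : Choices ℝ {n}) (r : ℕ) (τmax : Carrier) where
    open Choices choices
    open Algorithm ℝ choices ε r using (loop)

    -- The loop runs while the threshold exceeds θ.
    θ : Carrier
    θ = ε * τmax / (fromℕ r * (1# + ε))

    -- The loop ends within `fuel` passes if these many divisions by 1 + ε bring τ down to θ.
    loop-returns : ∀ fuel k τ S T → 0# ≤ τ → τ ≤ (1# + ε) ^ fuel * θ → Invariant τ S T →
      ∃[ s ] ∃[ τ′ ] Returns (loop fuel k τmax τ (S , T)) (just s) (fuel ℕ.* (n ℕ.* 6)) ×
        0# ≤ τ′ × τ′ ≤ θ × Invariant τ′ (proj₁ s) (proj₂ s)
    loop-returns fuel k τ S T 0≤τ τ≤ I with θ <? τ
    loop-returns fuel k τ S T 0≤τ τ≤ I | no θ≮τ = (S , T) , τ , returns-return , 0≤τ , ≮⇒≥ θ≮τ , I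
    loop-returns zero k τ S T 0≤τ τ≤ I | yes θ<τ =
      contradiction (≤-trans τ≤ (≤-reflexive (*-identityˡ θ))) (<⇒≱ θ<τ)
    loop-returns (suc fuel) k τ S T 0≤τ τ≤ I | yes θ<τ =
      let es , unique , es⇔ = order k S T
          outside-S∪T : ∀ {e} → e List.∈ es → e ∉ S ∪ T
          outside-S∪T e∈es = x∈∁p⇒x∉p (Equivalence.to (es⇔ _) e∈es)
          seen : ∀ {e} → e ∉ S → e ∉ T → ¬ ¬ (e List.∈ es)
          seen e∉S e∉T e∉es = e∉es (Equivalence.from (es⇔ _) (x∉p⇒x∈∁p ([ e∉S , e∉T ]′ ∘ x∈p∪q⁻ S T)))
          s₁ , ret₁ , I₁ = pass-returns (tie k) es (S , T) 0≤τ unique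
            ( I
            , (λ e∉S e∉T e∉es → contradiction e∉es (seen e∉S e∉T))
            , (λ e∉T e∉S e∉es → contradiction e∉es (seen e∉S e∉T))
            , λ e∈es → outside-S∪T e∈es ∘ p⊆p∪q T , outside-S∪T e∈es ∘ q⊆p∪q S T)
          0≤τ′ = /-nonNeg 0≤τ 0<1+ε
          τ≈ = ≈-sym (*-/ τ 0<1+ε)
          s₂ , τ″ , ret₂ , rest = loop-returns fuel (suc k) (τ / (1# + ε)) (proj₁ s₁) (proj₂ s₁) 0≤τ′
            (/-≤ 0<1+ε (≤-trans τ≤ (≤-reflexive (*-assoc _ _ _)))) (end-Invariant 0≤τ′ τ≈ I₁)
      in s₂ , τ″ , returns->>= (returns-≤ (ℕ.*-monoˡ-≤ 6 (unique-length unique)) ret₁) ret₂ , rest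

  -- The insertions into S pay for all the elements of O that S captures.
  charge-total : ∀ {O τ x y S T} → 0# ≤ τ → Independent O → Independent S → Account O τ x y S T →
    sum (charge O τ x S) ≤ p * f S
  charge-total {O} {τ} {x} {y} {S} 0≤τ indO indS h = begin
    sum (charge O τ x S)
      ≈⟨ sum-charge x S ⟩
    sum x + τ * fromℕ ∣ captured M O S ∣
      ≤⟨ +-monoʳ-≤ _ (*-monoˡ-≤ 0≤τ (captured-bound ℝ M 0≤p isPSet indO indS)) ⟩
    sum x + τ * (p * fromℕ ∣ S ∣)
      ≤⟨ x≤x+y (*-nonNeg 0≤p (nonNeg ⊥)) ⟩
    sum x + τ * (p * fromℕ ∣ S ∣) + p * f ⊥
      ≤⟨ budget h ⟩
    p * f S ∎

  f[O]≤f[S∪O]+f[T∪O] : ∀ {S T O} → (∀ {e} → e ∈ S → e ∉ T) → f O ≤ f (S ∪ O) + f (T ∪ O)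
  f[O]≤f[S∪O]+f[T∪O] {S} {T} {O} disjoint = begin
    f O
      ≡⟨ ≡.cong f intersection ⟨
    f ((S ∪ O) ∩ (T ∪ O))
      ≤⟨ x≤y+x (nonNeg _) ⟩
    f ((S ∪ O) ∪ (T ∪ O)) + f ((S ∪ O) ∩ (T ∪ O))
      ≤⟨ submodular (S ∪ O) (T ∪ O) ⟩
    f (S ∪ O) + f (T ∪ O) ∎
    where
    intersection : (S ∪ O) ∩ (T ∪ O) ≡ O
    intersection = ⊆-antisym
      (λ x∈ → let x∈S∪O , x∈T∪O = x∈p∩q⁻ (S ∪ O) (T ∪ O) x∈ in
        [ (λ x∈S → [ (λ x∈T → contradiction x∈T (disjoint x∈S)) , id ]′ (x∈p∪q⁻ T O x∈T∪O)) , id ]′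
          (x∈p∪q⁻ S O x∈S∪O))
      (λ x∈O → x∈p∩q⁺ (q⊆p∪q S O x∈O , q⊆p∪q T O x∈O))

  -- A bound on the gain for S of an element e of O, in terms of the charges.  If e lies in neither
  -- set, then its credit and τ pay for the gain; the term τ is wasted if S captures e.
  gainBound : (O : Subset n) (τ : Carrier) (x y : Fin n → Carrier) (S T : Subset n) →
    Fin n → Carrier
  gainBound O τ x y S T e with e ∈? S | e ∈? T
  ... | yes _ | _     = 0#
  ... | no _  | yes _ = (1# + ε) * (charge O τ x S e + charge O τ y T e)
  ... | no _  | no _  = (1# + ε) * (charge O τ x S e + τ * χ O e)

  account-gain : ∀ {O τ x y S T} → 0# ≤ τ → Account O τ x y S T → Account O τ y x T S →
    f (S ∪ O) ≤ f S + sum (gainBound O τ x y S T)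
  account-gain {O} {τ} {x} {y} {S} {T} 0≤τ hS hT = union-gain nonNegative gain≤
    where
    0≤chargeS = charge-nonNeg {O} {S = S} 0≤τ (credit-nonNeg hS)
    0≤chargeT = charge-nonNeg {O} {S = T} 0≤τ (credit-nonNeg hT)

    nonNegative : ∀ e → 0# ≤ gainBound O τ x y S T e
    nonNegative e with e ∈? S | e ∈? T
    ... | yes _ | _     = ≤-refl
    ... | no _  | yes _ = *-nonNeg 0≤1+ε (+-nonNeg (0≤chargeS e) (0≤chargeT e))
    ... | no _  | no _  = *-nonNeg 0≤1+ε (+-nonNeg (0≤chargeS e) (*-nonNeg 0≤τ (χ-nonNeg O e)))

    τ≤τχ : ∀ {e} → e ∈ O → τ ≤ τ * χ O e
    τ≤τχ e∈O = ≤-reflexive (≈-sym (≈-trans (*-congˡ (reflexive (χ-∈ e∈O))) (*-identityʳ τ)))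

    gain≤ : ∀ {e} → e ∈ O → f (S ∪ ⁅ e ⁆) ≤ f S + gainBound O τ x y S T e
    gain≤ {e} e∈O with e ∈? S | e ∈? T
    ... | yes e∈S | _     = ≤-trans (≡⇒≤ (≡.cong f (∪⁅⁆-absorb e∈S))) (x≤x+y ≤-refl)
    ... | no _ | yes e∈T  = gain-other hS e∈O e∈T
    ... | no e∉S | no e∉T = relax 0≤1+ε (gain-outside hS e∈O e∉S e∉T)
      (+-mono-≤ (x≤x+y (*-nonNeg 0≤τ (χ-nonNeg (captured M O S) e))) (τ≤τχ e∈O))

  -- The last term is the total left-over gain of the elements of O that are never captured.
  optimum-bound : ∀ {τ S T O} → 0# ≤ τ → Invariant τ S T → Independent O →
    f O ≤ f S + f T + (1# + ε) * (p * (f S + f T) + fromℕ 2 * τ * fromℕ ∣ O ∣)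
  optimum-bound {τ} {S} {T} {O} 0≤τ (invariant indS indT disjoint credit) indO with credit indO
  ... | accounts {x} {y} hS hT = begin
    f O
      ≤⟨ f[O]≤f[S∪O]+f[T∪O] disjoint ⟩
    f (S ∪ O) + f (T ∪ O)
      ≤⟨ +-mono-≤ (account-gain 0≤τ hS hT) (account-gain 0≤τ hT hS) ⟩
    f S + sum gS + (f T + sum gT)
      ≈⟨ solve 4 (λ a b c d → a :+ b :+ (c :+ d) := a :+ c :+ (b :+ d)) ≈-refl
           (f S) (sum gS) (f T) (sum gT) ⟩
    f S + f T + (sum gS + sum gT)
      ≤⟨ +-monoʳ-≤ _ sum-g ⟩
    f S + f T + (1# + ε) * (p * (f S + f T) + fromℕ 2 * τ * fromℕ ∣ O ∣) ∎
    where
    wS = charge O τ x S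
    wT = charge O τ y T
    0≤2τχ : ∀ e → 0# ≤ fromℕ 2 * τ * χ O e
    0≤2τχ e = *-nonNeg (*-nonNeg (fromℕ-nonNeg 2) 0≤τ) (χ-nonNeg O e)

    gS = gainBound O τ x y S T
    gT = gainBound O τ y x T S

    g-bound : ∀ e → gS e + gT e ≤ (1# + ε) * (wS e + wT e + fromℕ 2 * τ * χ O e)
    g-bound e with e ∈? S | e ∈? T
    ... | yes e∈S | yes e∈T = contradiction e∈T (disjoint e∈S)
    ... | yes _ | no _ = ≤-trans (≤-reflexive (+-identityˡ _)) (*-monoˡ-≤ 0≤1+ε
      (≤-trans (≤-reflexive (+-comm _ _)) (x≤x+y (0≤2τχ e))))
    ... | no _ | yes _ = ≤-trans (≤-reflexive (+-identityʳ _)) (*-monoˡ-≤ 0≤1+ε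
      (x≤x+y (0≤2τχ e)))
    ... | no _ | no _ = ≤-reflexive
      (solve 5 (λ a u v t c → a :* (u :+ t :* c) :+ a :* (v :+ t :* c)
                           := a :* (u :+ v :+ (con 1 :+ (con 1 :+ con 0)) :* t :* c)) ≈-refl
        (1# + ε) (wS e) (wT e) τ (χ O e))

    sum-g : sum gS + sum gT ≤ (1# + ε) * (p * (f S + f T) + fromℕ 2 * τ * fromℕ ∣ O ∣)
    sum-g = begin
      sum gS + sum gT
        ≈⟨ ∑-distrib-+ gS gT ⟨
      sum (λ e → gS e + gT e)
        ≤⟨ sum-mono g-bound ⟩
      sum (λ e → (1# + ε) * (wS e + wT e + fromℕ 2 * τ * χ O e))
        ≈⟨ *-distribˡ-sum (1# + ε) (λ e → wS e + wT e + fromℕ 2 * τ * χ O e) ⟨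
      (1# + ε) * sum (λ e → wS e + wT e + fromℕ 2 * τ * χ O e)
        ≈⟨ *-congˡ (≈-trans (∑-distrib-+ (λ e → wS e + wT e) (λ e → fromℕ 2 * τ * χ O e))
             (+-cong (∑-distrib-+ wS wT)
               (≈-trans (≈-sym (*-distribˡ-sum (fromℕ 2 * τ) (χ O))) (*-congˡ (sum-χ O))))) ⟩
      (1# + ε) * (sum wS + sum wT + fromℕ 2 * τ * fromℕ ∣ O ∣)
        ≤⟨ *-monoˡ-≤ 0≤1+ε (+-monoˡ-≤ _ (≤-trans
             (+-mono-≤ (charge-total 0≤τ indO indS hS) (charge-total 0≤τ indO indT hT))
             (≤-reflexive (≈-sym (distribˡ p (f S) (f T)))))) ⟩
      (1# + ε) * (p * (f S + f T) + fromℕ 2 * τ * fromℕ ∣ O ∣) ∎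

-- The approximation ratio and the number of passes

module Arithmetic (ℝ : Reals) where
  open Reals ℝ
  open OrderedField ℝ
  open CommutativeRing commutativeRing
    using (commutativeSemiring; +-identityʳ; *-comm; *-identityˡ; *-identityʳ; +-cong
          ; +-congˡ; +-congʳ; *-congˡ; *-congʳ)
    renaming (refl to ≈-refl; sym to ≈-sym; trans to ≈-trans)
  open NaturalSolver commutativeSemiring using (solve; _:+_; _:*_; _:=_; con)
  open Exp semiring using (^-assocʳ)
  open PosetReasoning ≤-poset

  -- Multiplied by 2 p + 2, the subtracted ε m becomes 2 p ε m + 2 ε m.  This covers the terms 2 p ε F,
  -- because F ≤ m, and 2 ε m of the hypothesis.
  approximation-ratio : ∀ {p ε m F} → 0# ≤ p → 0# ≤ ε → F ≤ m →
    m ≤ fromℕ 2 * F + (1# + ε) * (p * (fromℕ 2 * F)) + fromℕ 2 * (ε * m) →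
    (1# / (fromℕ 2 * p + fromℕ 2) - ε) * m ≤ F
  approximation-ratio {p} {ε} {m} {F} 0≤p 0≤ε F≤m h = *-cancelˡ-≤ 0<a (+-cancelʳ-≤ (a * ε * m) (begin
    a * (d * m) + a * ε * m
      ≈⟨ solve 4 (λ a d e m → a :* (d :* m) :+ a :* e :* m := a :* (d :+ e) :* m) ≈-refl a d ε m ⟩
    a * (d + ε) * m
      ≈⟨ *-congʳ (≈-trans (*-congˡ (x-z+z≈x (1# / a) ε)) (*-/ 1# 0<a)) ⟩
    1# * m
      ≈⟨ *-identityˡ m ⟩
    m
      ≤⟨ linear (+-mono-≤ h (*-monoˡ-≤ (*-nonNeg (*-nonNeg (fromℕ-nonNeg 2) 0≤p) 0≤ε) F≤m))
           (solve 4 (λ m F p e →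
              let two = con 1 :+ (con 1 :+ con 0) in
              m :+ ((two :* F :+ (con 1 :+ e) :* (p :* (two :* F)) :+ two :* (e :* m))
                   :+ two :* p :* e :* m)
                := ((two :* p :+ two) :* F :+ (two :* p :+ two) :* e :* m)
                   :+ (m :+ two :* p :* e :* F))
              ≈-refl m F p ε) ⟩
    a * F + a * ε * m ∎))
    where
    a = fromℕ 2 * p + fromℕ 2
    d = 1# / a - ε
    0<a : 0# < a
    0<a = <-≤-trans (0<fromℕ 2) (x≤y+x (*-nonNeg (fromℕ-nonNeg 2) 0≤p))

  module Passes (ε : Carrier) (0<ε : 0# < ε) (ε<1 : ε < 1#) (r : ℕ) (1≤r : 1 ℕ.≤ r) where

    private
      0≤ε = <⇒≤ 0<ε
      ceil-1/ε = let N , ε⁻¹≤N = archimedean (ε ⁻¹) in least fromℕ (ε ⁻¹) N ε⁻¹≤N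
      b = proj₁ ceil-1/ε
      ceil-log = ceilLog₂ (fromℕ r / ε)
      a = proj₁ ceil-log
      0≤ε⁻¹ = ⁻¹-nonNeg 0<ε
      1≤ε⁻¹ : 1# ≤ ε ⁻¹
      1≤ε⁻¹ = *-cancelˡ-≤ 0<ε (≤-trans (≤-reflexive (*-identityʳ ε))
        (≤-trans (<⇒≤ ε<1) (≤-reflexive (≈-sym (*-inverseʳ (<⇒≉0 0<ε))))))

    0<r[1+ε] : 0# < fromℕ r * (1# + ε)
    0<r[1+ε] = <-≤-trans (0<fromℕ r {{ℕ.>-nonZero 1≤r}}) (≤-trans (≤-reflexive (≈-sym (*-identityʳ _)))
      (*-monoˡ-≤ (fromℕ-nonNeg r) (x≤x+y 0≤ε)))

    -- With b = ⌈ 1 / ε ⌉ and a = ⌈ log₂ (r / ε) ⌉, each b passes at least halve the threshold, and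
    -- a + 1 halvings bring it down to the final value.
    passes : ℕ
    passes = b ℕ.* suc a

    growth : (1# + ε) * (fromℕ r / ε) ≤ (1# + ε) ^ passes
    growth = begin
      (1# + ε) * (fromℕ r / ε)
        ≤⟨ *-mono-≤ (fromℕ-nonNeg 2) (/-nonNeg (fromℕ-nonNeg r) 0<ε)
             (+-monoʳ-≤ 1# (≤-trans (<⇒≤ ε<1) (≤-reflexive (≈-sym (+-identityʳ 1#)))))
             (proj₁ (proj₂ ceil-log)) ⟩
      fromℕ 2 ^ suc a
        ≤⟨ ^-mono-≤ (suc a) (fromℕ-nonNeg 2) 2≤ ⟩
      ((1# + ε) ^ b) ^ suc a
        ≈⟨ ^-assocʳ (1# + ε) b (suc a) ⟩
      (1# + ε) ^ passes ∎
      where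
      2≤ : fromℕ 2 ≤ (1# + ε) ^ b
      2≤ = begin
        1# + (1# + 0#)   ≈⟨ +-congˡ (+-identityʳ 1#) ⟩
        1# + 1#          ≈⟨ +-congˡ (≈-trans (*-comm _ _) (*-inverseʳ (<⇒≉0 0<ε))) ⟨
        1# + ε ⁻¹ * ε    ≤⟨ +-monoʳ-≤ 1# (*-monoʳ-≤ 0≤ε (proj₁ (proj₂ ceil-1/ε))) ⟩
        1# + fromℕ b * ε ≤⟨ bernoulli b 0≤ε ⟩
        (1# + ε) ^ b     ∎

    threshold : ∀ {τmax} → 0# ≤ τmax → τmax ≤ (1# + ε) ^ passes * (ε * τmax / (fromℕ r * (1# + ε)))
    threshold {τmax} 0≤τmax = *-cancelˡ-≤ 0<ε (begin
      ε * τmax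
        ≈⟨ *-/ (ε * τmax) 0<r[1+ε] ⟨
      fromℕ r * (1# + ε) * θ
        ≈⟨ *-congʳ (*-congʳ (*-/ (fromℕ r) 0<ε)) ⟨
      ε * (fromℕ r / ε) * (1# + ε) * θ
        ≈⟨ solve 4 (λ e x d t → e :* x :* d :* t := e :* (d :* x :* t)) ≈-refl
             ε (fromℕ r / ε) (1# + ε) θ ⟩
      ε * ((1# + ε) * (fromℕ r / ε) * θ)
        ≤⟨ *-monoˡ-≤ 0≤ε (*-monoʳ-≤ (/-nonNeg (*-nonNeg 0≤ε 0≤τmax) 0<r[1+ε]) growth) ⟩
      ε * ((1# + ε) ^ passes * θ) ∎)
      where
      θ = ε * τmax / (fromℕ r * (1# + ε))

    passes≤ : ∀ {L} → IsLog₂ (fromℕ r / ε) L → 1# ≤ L → fromℕ passes ≤ fromℕ 6 * (ε ⁻¹ * L)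
    passes≤ {L} isLog 1≤L = begin
      fromℕ (b ℕ.* suc a)
        ≈⟨ fromℕ-* b (suc a) ⟩
      fromℕ b * fromℕ (suc a)
        ≤⟨ *-mono-≤ (*-nonNeg (fromℕ-nonNeg 2) 0≤ε⁻¹) (fromℕ-nonNeg (suc a)) b≤ a≤ ⟩
      fromℕ 2 * ε ⁻¹ * (fromℕ 3 * L)
        ≈⟨ solve 4 (λ u v x y → u :* x :* (v :* y) := (u :* v) :* (x :* y)) ≈-refl
             (fromℕ 2) (fromℕ 3) (ε ⁻¹) L ⟩
      fromℕ 2 * fromℕ 3 * (ε ⁻¹ * L)
        ≈⟨ *-congʳ (fromℕ-* 2 3) ⟨
      fromℕ 6 * (ε ⁻¹ * L) ∎
      where
      b≤ : fromℕ b ≤ fromℕ 2 * ε ⁻¹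
      b≤ with b in eq
      ... | zero  = *-nonNeg (fromℕ-nonNeg 2) 0≤ε⁻¹
      ... | suc j = ≤-trans (+-mono-≤ 1≤ε⁻¹ (proj₂ (proj₂ ceil-1/ε) eq))
        (≤-reflexive (x+x≈2x (ε ⁻¹)))
      a≤ : fromℕ (suc a) ≤ fromℕ 3 * L
      a≤ with a in eq
      ... | zero  = ≤-trans (≤-reflexive (+-identityʳ 1#)) (≤-trans 1≤L
        (≤-trans (≤-reflexive (≈-sym (*-identityˡ L))) (*-monoʳ-≤ (≤-trans 0≤1 1≤L) (1≤fromℕ 3))))
      ... | suc j = ≤-trans
        (+-mono-≤ 1≤L (+-mono-≤ 1≤L (2^a≤x⇒a≤log₂ isLog j (proj₂ (proj₂ ceil-log) eq))))
        (≤-reflexive (solve 1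
          (λ u → u :+ (u :+ u) := (con 1 :+ (con 1 :+ (con 1 :+ con 0))) :* u) ≈-refl L))

    -- There are at most 2 n queries for τmax, 6 n for each pass and 2 for the final comparison.  As n,
    -- L and 1 / ε are at least 1, these amount to at most (2 + 6 * 6 + 2) * (n / ε) * L.
    total-queries : ∀ {n T L} → 1 ℕ.≤ n → IsLog₂ (fromℕ r / ε) L → 1# ≤ L →
      T ℕ.≤ n ℕ.* 2 ℕ.+ (passes ℕ.* (n ℕ.* 6) ℕ.+ 2) → fromℕ T ≤ fromℕ 40 * ((fromℕ n / ε) * L)
    total-queries {n} {T} {L} 1≤n isLog 1≤L T≤ = begin
      fromℕ T
        ≤⟨ fromℕ-mono-≤ T≤ ⟩
      fromℕ (n ℕ.* 2 ℕ.+ (passes ℕ.* (n ℕ.* 6) ℕ.+ 2))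
        ≈⟨ ≈-trans (fromℕ-+ (n ℕ.* 2) _) (+-cong (fromℕ-* n 2)
             (≈-trans (fromℕ-+ (passes ℕ.* (n ℕ.* 6)) 2) (+-congʳ
               (≈-trans (fromℕ-* passes (n ℕ.* 6)) (*-congˡ (fromℕ-* n 6)))))) ⟩
      fromℕ n * fromℕ 2 + (fromℕ passes * (fromℕ n * fromℕ 6) + fromℕ 2)
        ≤⟨ +-mono-≤ (*-monoʳ-≤ (fromℕ-nonNeg 2) n≤U) (+-mono-≤
             (*-monoʳ-≤ (*-nonNeg (fromℕ-nonNeg n) (fromℕ-nonNeg 6)) (passes≤ isLog 1≤L))
             (≤-trans (≤-reflexive (≈-sym (*-identityˡ _)))
               (*-monoʳ-≤ (fromℕ-nonNeg 2) (≤-trans (1≤fromℕ n) n≤U)))) ⟩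
      U * fromℕ 2 + (fromℕ 6 * (ε ⁻¹ * L) * (fromℕ n * fromℕ 6) + U * fromℕ 2)
        ≈⟨ solve 5 (λ n u l two six →
               n :* u :* l :* two :+ (six :* (u :* l) :* (n :* six) :+ n :* u :* l :* two)
                 := (two :+ (six :* six :+ two)) :* (n :* u :* l)) ≈-refl
             (fromℕ n) (ε ⁻¹) L (fromℕ 2) (fromℕ 6) ⟩
      (fromℕ 2 + (fromℕ 6 * fromℕ 6 + fromℕ 2)) * U
        ≈⟨ *-congʳ (≈-trans (fromℕ-+ 2 38)
             (+-congˡ (≈-trans (fromℕ-+ 36 2) (+-congʳ (fromℕ-* 6 6))))) ⟨
      fromℕ 40 * U ∎
      where
      instance _ = ℕ.>-nonZero 1≤n
      U = (fromℕ n / ε) * L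
      n≤U : fromℕ n ≤ U
      n≤U = begin
        fromℕ n           ≈⟨ ≈-trans (*-identityʳ _) (*-identityʳ _) ⟨
        fromℕ n * 1# * 1# ≤⟨ *-mono-≤ (*-nonNeg (fromℕ-nonNeg n) 0≤ε⁻¹) 0≤1
                               (*-monoˡ-≤ (fromℕ-nonNeg n) 1≤ε⁻¹) 1≤L ⟩
        U                 ∎

-- The result of the algorithm

module _ (ℝ : Reals) {n : ℕ} (M : IndependenceSystem n) (f : Subset n → Reals.Carrier ℝ)
         (choices : Choices ℝ {n}) (ε : Reals.Carrier ℝ) (r : ℕ) where
  open Reals ℝ
  open OrderedField ℝ
  open Queries ℝ M f
  open Choices choices
  open Algorithm ℝ choices ε r using (best)
  open AddInfimum _≤_ using ([≤]-injective)

  private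
    choose : Subset n → Subset n → Index ℝ {n} → Subset n
    choose S T first  = S
    choose S T second = T

    run-best : ∀ S T →
      run ℝ M f (best (S , T)) ≡ (choose S T (argmax ℝ {n} finalTie [ f S ] [ f T ]) , 2)
    run-best S T with argmax ℝ {n} finalTie [ f S ] [ f T ]
    ... | first  = refl
    ... | second = refl

  best-returns : ∀ S T →
    ∃[ S* ] Returns (best (S , T)) S* 2 × (S* ≡ S ⊎ S* ≡ T) × f S ≤ f S* × f T ≤ f S*
  best-returns S T = _ , returns (run-best S T) ℕ.≤-refl , maximal
    where
    i = argmax ℝ {n} finalTie [ f S ] [ f T ]
    maximal : (choose S T i ≡ S ⊎ choose S T i ≡ T) × f S ≤ f (choose S T i) × f T ≤ f (choose S T i)
    maximal with argmax ℝ {n} finalTie [ f S ] [ f T ] in eq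
    ... | first  = inj₁ refl , ≤-refl , [≤]-injective (argmax-first finalTie _ _ eq)
    ... | second = inj₂ refl , [≤]-injective (argmax-second finalTie _ _ eq) , ≤-refl

  twinGreedyFast-returns : ∀ {fuel τmax S T S* c d} →
    Returns (maxSingleton ℝ (allFin n)) [ τmax ] c →
    Returns (Algorithm.loop ℝ choices ε r fuel 0 τmax τmax (⊥ , ⊥)) (just (S , T)) d →
    Returns (best (S , T)) S* 2 →
    Returns (twinGreedyFast ℝ choices ε r fuel) (just S*) (c ℕ.+ (d ℕ.+ 2))
  twinGreedyFast-returns ret-max ret-loop ret-best =
    returns->>= ret-max (returns->>= ret-loop (returns->>= ret-best (returns-return {c = 0})))

module Solution (ℝ : Reals) {n : ℕ} (M : IndependenceSystem n)
  (p : Reals.Carrier ℝ) (0≤p : Reals._≤_ ℝ (Reals.0# ℝ) p) (isPSet : IsPSetSystem ℝ p M)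
  (r : ℕ) (1≤r : 1 ℕ.≤ r) (isRank : IndependenceSystem.IsRank M r)
  (f : Subset n → Reals.Carrier ℝ) (submodular : Submodular ℝ f) (nonNeg : NonNegative ℝ f)
  (ε : Reals.Carrier ℝ) (0<ε : Reals._<_ ℝ (Reals.0# ℝ) ε) (ε<1 : Reals._<_ ℝ ε (Reals.1# ℝ))
  (choices : Choices ℝ {n}) where

  open Reals ℝ
  open OrderedField ℝ
  open IndependenceSystem M
  open CommutativeRing commutativeRing using (commutativeSemiring; *-identityʳ)
    renaming (refl to ≈-refl)
  open NaturalSolver commutativeSemiring using (solve; _:+_; _:*_; _:=_)
  open PosetReasoning ≤-poset
  open Queries ℝ M f
  open AddInfimum _≤_ using (_≤₋_; [≤]-injective)
  open Arithmetic ℝ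
  open Passes ε 0<ε ε<1 r 1≤r
  open Analysis ℝ M p 0≤p isPSet f submodular nonNeg ε 0<ε

  approximation : ∀ {τmax τ S T S*} → 0# ≤ τ → τ ≤ ε * τmax / (fromℕ r * (1# + ε)) →
    ∃[ e ] Independent ⁅ e ⁆ × f ⁅ e ⁆ ≡ τmax → Invariant τ S T →
    Independent S* → f S ≤ f S* → f T ≤ f S* →
    ∀ opt → IsMaximum ℝ M f opt → (1# / (fromℕ 2 * p + fromℕ 2) - ε) * opt ≤ f S*
  approximation {τmax} {τ} {S} {T} {S*} 0≤τ τ≤θ (e , ind-e , refl) I indS* fS≤ fT≤
    opt ((O , indO , fO≈opt) , opt-max) =
    approximation-ratio 0≤p 0≤ε (opt-max S* indS*) (begin
      opt
        ≈⟨ fO≈opt ⟨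
      f O
        ≤⟨ optimum-bound 0≤τ I indO ⟩
      f S + f T + (1# + ε) * (p * (f S + f T) + fromℕ 2 * τ * fromℕ ∣ O ∣)
        ≤⟨ +-mono-≤ fS+fT≤ (*-monoˡ-≤ 0≤1+ε (+-mono-≤ (*-monoˡ-≤ 0≤p fS+fT≤)
             (*-monoˡ-≤ (*-nonNeg (fromℕ-nonNeg 2) 0≤τ) (fromℕ-mono-≤ (proj₂ isRank O indO))))) ⟩
      fromℕ 2 * F + (1# + ε) * (p * (fromℕ 2 * F) + fromℕ 2 * τ * fromℕ r)
        ≈⟨ solve 6 (λ F a p t r two → two :* F :+ a :* (p :* (two :* F) :+ two :* t :* r)
                                := two :* F :+ a :* (p :* (two :* F)) :+ two :* (r :* a :* t)) ≈-refl
             F (1# + ε) p τ (fromℕ r) (fromℕ 2) ⟩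
      fromℕ 2 * F + (1# + ε) * (p * (fromℕ 2 * F)) + fromℕ 2 * (fromℕ r * (1# + ε) * τ)
        ≤⟨ +-monoʳ-≤ _ (*-monoˡ-≤ (fromℕ-nonNeg 2) leftover) ⟩
      fromℕ 2 * F + (1# + ε) * (p * (fromℕ 2 * F)) + fromℕ 2 * (ε * opt) ∎)
    where
    F = f S*
    fS+fT≤ : f S + f T ≤ fromℕ 2 * F
    fS+fT≤ = ≤-trans (+-mono-≤ fS≤ fT≤)
      (≤-reflexive (x+x≈2x F))
    leftover : fromℕ r * (1# + ε) * τ ≤ ε * opt
    leftover = begin
      fromℕ r * (1# + ε) * τ ≤⟨ *-monoˡ-≤ (<⇒≤ 0<r[1+ε]) τ≤θ ⟩
      fromℕ r * (1# + ε) * (ε * f ⁅ e ⁆ / (fromℕ r * (1# + ε))) ≈⟨ *-/ _ 0<r[1+ε] ⟩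
      ε * f ⁅ e ⁆            ≤⟨ *-monoˡ-≤ 0≤ε (opt-max ⁅ e ⁆ ind-e) ⟩
      ε * opt                ∎

  private
    A = proj₁ (proj₁ isRank)
    ∣A∣≡r = proj₂ (proj₂ (proj₁ isRank))

  1≤n : 1 ℕ.≤ n
  1≤n = ℕ.≤-trans 1≤r (ℕ.≤-trans (ℕ.≤-reflexive (≡.sym ∣A∣≡r)) (∣p∣≤n A))

  independent-singleton : ∃[ e ] Independent ⁅ e ⁆
  independent-singleton =
    let e , e∈A = ∣A∣≥1⇒∃∈ A (≡.subst (1 ℕ.≤_) (≡.sym ∣A∣≡r) 1≤r)
    in e , ⊆-indep (⁅⁆-⊆ e∈A) (proj₁ (proj₂ (proj₁ isRank)))

  -- A run of the algorithm with the given fuel that returns a solution of the required quality.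
  record Result (fuel : ℕ) : Set where
    field
      S*          : Subset n
      result      : Returns (twinGreedyFast ℝ choices ε r fuel) (just S*)
                      (n ℕ.* 2 ℕ.+ (fuel ℕ.* (n ℕ.* 6) ℕ.+ 2))
      independent : Independent S*
      ratio       : ∀ opt → IsMaximum ℝ M f opt → (1# / (fromℕ 2 * p + fromℕ 2) - ε) * opt ≤ f S*

  result-from : ∀ {m} → Returns (maxSingleton ℝ (allFin n)) m (length (allFin n) ℕ.* 2) →
    (∀ {e} → e List.∈ allFin n → Independent ⁅ e ⁆ → [ f ⁅ e ⁆ ] ≤₋ m) → Attained m → Result passes
  result-from {⊥₋} _ upper _ with upper (∈-allFin _) (proj₂ independent-singleton)
  ... | ()
  result-from {[ τmax ]} ret-max upper attained =
    let e , ind-e , f≡τmax = attained refl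
        0≤τmax = ≡.subst (0# ≤_) f≡τmax (nonNeg ⁅ e ⁆)
        (S , T) , τ , ret-loop , 0≤τ , τ≤θ , I = loop-returns choices r τmax passes 0 τmax ⊥ ⊥ 0≤τmax
          (threshold 0≤τmax) (start-Invariant 0≤τmax λ ind → [≤]-injective (upper (∈-allFin _) ind))
        S* , ret-best , S*∈ , fS≤ , fT≤ = best-returns ℝ M f choices ε r S T
        indS* = [ (λ eq → ≡.subst Independent (≡.sym eq) (Invariant.indS I))
                , (λ eq → ≡.subst Independent (≡.sym eq) (Invariant.indT I)) ]′ S*∈
    in record
      { S*          = S*
      ; result      = twinGreedyFast-returns ℝ M f choices ε r
          (returns-≤ (ℕ.≤-reflexive (≡.cong (ℕ._* 2) (length-tabulate {n = n} id))) ret-max)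
          ret-loop ret-best
      ; independent = indS*
      ; ratio       = approximation 0≤τ τ≤θ (e , ind-e , f≡τmax) I indS* fS≤ fT≤
      }

  solution : Result passes
  solution =
    let m , ret , upper , attained = maxSingleton-returns (allFin n)
    in result-from ret upper attained

  query-bound : ∀ {T} → T ℕ.≤ n ℕ.* 2 ℕ.+ (passes ℕ.* (n ℕ.* 6) ℕ.+ 2) →
    fromℕ 2 ≤ fromℕ r / ε → ∃[ L ] IsLog₂ (fromℕ r / ε) L × fromℕ T ≤ fromℕ 40 * ((fromℕ n / ε) * L)
  query-bound T≤ 2≤x =
    let L , isLog = log₂-exists (≤-trans (1≤fromℕ 2) 2≤x)
        1≤L = ≤-trans (1≤fromℕ 1) (2^a≤x⇒a≤log₂ isLog 1 (≤-trans (≤-reflexive (*-identityʳ _)) 2≤x))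
    in L , isLog , total-queries 1≤n isLog 1≤L T≤

theorem3 : ∃[ C ]
    ((ℝ : Reals) →
    let open Reals ℝ in
    ∀ (n : ℕ) (M : IndependenceSystem n) →
    let open IndependenceSystem M in
    ∀ (p : Carrier) → 1# ≤ p → IsPSetSystem ℝ p M →
    ∀ (r : ℕ) → IsRank r → 1 ℕ.≤ r →
    ∀ (f : Subset n → Carrier) →
    Submodular ℝ f → NonNegative ℝ f → NonMonotone ℝ f →
    ∀ (ε : Carrier) → 0# < ε → ε < 1# →
    ∀ (choices : Choices ℝ {n}) →
    ∃[ fuel ] ∃[ S* ] ∃[ T ]
    run ℝ M f (twinGreedyFast ℝ choices ε r fuel) ≡ (just S* , T) ×
    Independent S* ×
    (∀ opt → IsMaximum ℝ M f opt →
    (1# / (fromℕ 2 * p + fromℕ 2) - ε) * opt ≤ f S*) ×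
    (fromℕ 2 ≤ fromℕ r / ε →
    ∃[ L ] IsLog₂ (fromℕ r / ε) L ×
    fromℕ T ≤ fromℕ C * ((fromℕ n / ε) * L)))
theorem3 = 40 , λ ℝ n M p 1≤p isPSet r isRank 1≤r f submodular nonNeg _ ε 0<ε ε<1 choices →
  let open OrderedField ℝ
      module Sol = Solution ℝ M p (≤-trans 0≤1 1≤p) isPSet r 1≤r isRank f submodular nonNeg
                     ε 0<ε ε<1 choices
      open Sol.Result Sol.solution
      open Queries.Returns result
  in _ , S* , queries , run≡ , independent , ratio , Sol.query-bound queries≤
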